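{- For every $n$-vertex graph $G$ with Euler genus $g$, $$\mathrm{qn}(G)<\mathrm{tn}(G)\le 6g+9(1+\log_{3/2}n).$$
   Context: Graphs are finite, simple and undirected. The Euler genus of a surface $\Sigma$ is $2-\chi(\Sigma)$, where $\chi$ is the Euler characteristic; the Euler genus of a graph is the minimum Euler genus of a surface in which it embeds. Queue-number: in a linear ordering $\preceq$ of $V(G)$, two edges $vw$ and $xy$ are nested if $v\prec x\prec y\prec w$. A $k$-queue layout of $G$ consists of a linear ordering $\preceq$ of $V(G)$ and a partition $E_1,\dots,E_k$ of $E(G)$ such that no two edges in the same $E_i$ are nested. The queue-number $\mathrm{qn}(G)$ is the minimum $k$ such that $G$ has a $k$-queue layout. Track-number: a $t$-track assignment of $G$ is a partition $\{V_i:i\in I\}$ of $V(G)$ with $|I|=t$ such that the ends of every edge lie in different parts, together with a total order $\preceq_i$ on each $V_i$. An X-crossing consists of two edges $vw$ and $xy$ with $v,x\in V_i$, $w,y\in V_j$, $v\prec_i x$ and $y\prec_j w$, for distinct $i,j$. A $t$-track layout is a $t$-track assignment with no X-crossing. The track-number $\mathrm{tn}(G)$ is the minimum $t$ such that $G$ has a $t$-track layout. -}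

module Defs where

open import Algebra.Definitions using (Involutive)
open import Data.Fin using (Fin)
open import Data.Integer as ℤ using (ℤ; +_; -[1+_])
open import Data.Nat as ℕ using (ℕ; suc)
open import Data.Product using (Σ; ∃; ∃₂; _×_; proj₁)
open import Data.Rational.Unnormalised as ℚ using (ℚᵘ; mkℚᵘ)
open import Data.Sum using (_⊎_)
open import Function.Base using (_on_)
open import Function.Bundles using (_⇔_)
open import Function.Definitions using (Injective; StrictlySurjective)
open import Level using (Level; 0ℓ)
open import Relation.Binary.Construct.Closure.ReflexiveTransitive using (Star)
open import Relation.Binary.Core using (Rel)
open import Relation.Binary.Definitions using (Symmetric; Irreflexive; Decidable)
open import Relation.Binary.PropositionalEquality using (_≡_; _≢_)
open import Relation.Binary.Structures using (IsStrictTotalOrder)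
open import Relation.Nullary using (¬_)

private
  variable
    ℓ : Level

IsMinimum : (ℕ → Set ℓ) → ℕ → Set ℓ
IsMinimum P k = P k × (∀ j → P j → k ℕ.≤ j)

record Graph (n : ℕ) : Set₁ where
  field
    Adj         : Rel (Fin n) 0ℓ
    adj?        : Decidable Adj
    symmetric   : Symmetric Adj
    irreflexive : Irreflexive _≡_ Adj

------------------------------------------------------------------------
-- Queue layouts

record QueueLayout {n : ℕ} (G : Graph n) (k : ℕ) : Set₁ where
  open Graph G
  field
    _≺_                : Rel (Fin n) 0ℓ
    isStrictTotalOrder : IsStrictTotalOrder _≡_ _≺_
    queue              : ∀ {v w} → Adj v w → Fin k
    -- The queue depends only on the unordered pair of ends.
    queue-unordered    : ∀ {v w} (e : Adj v w) (e′ : Adj w v) → queue e ≡ queue e′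
    noNesting          : ∀ {v w x y} (e : Adj v w) (f : Adj x y) → queue e ≡ queue f →
                         ¬ (v ≺ x × x ≺ y × y ≺ w)

IsQueueNumber : ∀ {n} → Graph n → ℕ → Set₁
IsQueueNumber G = IsMinimum (QueueLayout G)

------------------------------------------------------------------------
-- Track layouts

record TrackAssignment {n : ℕ} (G : Graph n) (t : ℕ) : Set₁ where
  open Graph G
  field
    track  : Fin n → Fin t
    proper : ∀ {v w} → Adj v w → track v ≢ track w

  Track : Fin t → Set
  Track i = ∃ λ v → track v ≡ i

  field
    _≺_                : ∀ {i} → Rel (Track i) 0ℓ
    isStrictTotalOrder : ∀ i → IsStrictTotalOrder (_≡_ on proj₁) (_≺_ {i})

  XCrossing : Set
  XCrossing =
    ∃₂ λ i j → i ≢ j ×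
    ∃₂ λ (v x : Track i) → ∃₂ λ (w y : Track j) →
    Adj (proj₁ v) (proj₁ w) × Adj (proj₁ x) (proj₁ y) × v ≺ x × y ≺ w

TrackLayout : ∀ {n} → Graph n → ℕ → Set₁
TrackLayout G t = Σ (TrackAssignment G t) λ A → ¬ TrackAssignment.XCrossing A

IsTrackNumber : ∀ {n} → Graph n → ℕ → Set₁
IsTrackNumber G = IsMinimum (TrackLayout G)

------------------------------------------------------------------------
-- Surfaces

record Classes {A : Set} (_∼_ : Rel A 0ℓ) : Set where
  field
    size             : ℕ
    class            : A → Fin size
    class-surjective : StrictlySurjective _≡_ class
    class-≡⇔∼        : ∀ {a b} → class a ≡ class b ⇔ a ∼ b

-- For involutions f and g on a finite set, this is the orbit relation of the
-- group they generate.
Orbit₂ : {A : Set} → (f g : A → A) → Rel A 0ℓ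
Orbit₂ f g = Star λ a b → b ≡ f a ⊎ b ≡ g a

-- A connected closed surface, orientable or not, with a decomposition into
-- vertices, edges and open discs (loops and parallel edges are allowed).  The
-- flags are the triangles of the barycentric subdivision; θᵢ sends a flag to
-- the one across the side opposite its corner of dimension i, that is, it
-- changes the vertex (i = 0), edge (i = 1) or face (i = 2) and keeps the other
-- two.  Thus the cells of dimension i are the orbits of the two remaining
-- involutions.  Every connected closed surface arises in this way, and the
-- triangles of any such system glue to one.
record CellularSurface : Set where
  field
    flags           : ℕ
    someFlag        : Fin flags
    θ₀ θ₁ θ₂        : Fin flags → Fin flags
    θ₀-involutive   : Involutive _≡_ θ₀
    θ₁-involutive   : Involutive _≡_ θ₁
    θ₂-involutive   : Involutive _≡_ θ₂
    θ₀-free         : ∀ a → θ₀ a ≢ a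
    θ₁-free         : ∀ a → θ₁ a ≢ a
    θ₂-free         : ∀ a → θ₂ a ≢ a
    -- Exactly four flags surround each edge.
    θ₀θ₂-commute    : ∀ a → θ₀ (θ₂ a) ≡ θ₂ (θ₀ a)
    θ₀θ₂-free       : ∀ a → θ₀ (θ₂ a) ≢ a
    connected       : ∀ a b → Star (λ c d → d ≡ θ₀ c ⊎ d ≡ θ₁ c ⊎ d ≡ θ₂ c) a b
    vertices        : Classes (Orbit₂ θ₁ θ₂)
    edges           : Classes (Orbit₂ θ₀ θ₂)
    faces           : Classes (Orbit₂ θ₀ θ₁)

  Vertex : Set
  Vertex = Fin (Classes.size vertices)

  vertexOf : Fin flags → Vertex
  vertexOf = Classes.class vertices

  eulerCharacteristic : ℤ
  eulerCharacteristic =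
    + Classes.size vertices ℤ.- + Classes.size edges ℤ.+ + Classes.size faces

  eulerGenus : ℤ
  eulerGenus = + 2 ℤ.- eulerCharacteristic

------------------------------------------------------------------------
-- Euler genus of a graph

-- The graph is drawn in the 1-skeleton.  The decomposition may have further
-- vertices and edges, so the graph need not be connected nor its own faces be
-- discs; any embedding in a surface extends to a decomposition of this kind.
record Embedding {n : ℕ} (G : Graph n) (S : CellularSurface) : Set where
  open Graph G
  open CellularSurface S
  field
    vertex           : Fin n → Vertex
    vertex-injective : Injective _≡_ _≡_ vertex
    edge             : ∀ {v w} → Adj v w →
                       ∃ λ a → vertexOf a ≡ vertex v × vertexOf (θ₀ a) ≡ vertex w

EmbedsWithEulerGenus : ∀ {n} → Graph n → ℕ → Set
EmbedsWithEulerGenus G g =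
  Σ CellularSurface λ S → CellularSurface.eulerGenus S ≡ + g × Embedding G S

IsEulerGenus : ∀ {n} → Graph n → ℕ → Set
IsEulerGenus G = IsMinimum (EmbedsWithEulerGenus G)

------------------------------------------------------------------------
-- Logarithm

-- For n ≥ 1 and r = p / q with q > 0, r ≤ log_{3/2} n means (3/2)ᵖ ≤ n^q; the
-- powers of 2 and 3 are moved to the side where their exponent is positive.
infix 4 _≤log₃/₂_
_≤log₃/₂_ : ℚᵘ → ℕ → Set
mkℚᵘ (+ p)    q-1 ≤log₃/₂ n = 3 ℕ.^ p ℕ.≤ n ℕ.^ suc q-1 ℕ.* 2 ℕ.^ p
mkℚᵘ -[1+ p ] q-1 ≤log₃/₂ n = 2 ℕ.^ suc p ℕ.≤ n ℕ.^ suc q-1 ℕ.* 3 ℕ.^ suc p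

-- x ≤ a + b (1 + log_{3/2} n) for rational a, b, x with b > 0.  As
-- (x - a) / b - 1 is rational, the bound holds exactly when some rational
-- r ≤ log_{3/2} n already witnesses it.
infix 4 _≤_+_*[1+log₃/₂_]
_≤_+_*[1+log₃/₂_] : ℚᵘ → ℚᵘ → ℚᵘ → ℕ → Set
x ≤ a + b *[1+log₃/₂ n ] =
  ∃ λ r → r ≤log₃/₂ n × x ℚ.≤ a ℚ.+ b ℚ.* (ℚ.1ℚᵘ ℚ.+ r)

module Submission where

-- Let T be a breadth-first tree of the 1-skeleton of the surface; its depth is
-- the layering.  The dual graph that avoids T is connected, and a spanning tree C
-- of it misses exactly g of the edges outside T.  The 2g paths of T that rise
-- from the ends of these g edges meet each layer in at most 2g vertices, and
-- they get their own 6g tracks.  A vertex u off these paths is above no end of a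
-- missed edge, so the faces around the subtree of T above u hang together in C.
-- Hence, after the faces are fanned into triangles, C becomes a tree
-- decomposition in which the bag of a triangle consists of the three paths of T
-- from its corners, at most three vertices per layer.  A centroid bag halves
-- the graph; recursion gives 1 + ⌊log₂ n⌋ ≤ 1 + log_{3/2} n stages of three
-- colours, and the tracks are the pairs of a colour and a layer modulo 3.
-- Within a track, vertices are ordered by layer and then by the place of their
-- piece in the recursion.
--
-- For the queue layout, concatenate the tracks: edges that span the same number
-- of tracks and are nested would form an X-crossing.

open import Defs
open import Algebra.Definitions using (Involutive)
open import Data.Empty using (⊥-elim)
open import Data.Fin as Fin using (Fin; zero; suc; toℕ; fromℕ<)
import Data.Fin.Properties as Finₚ
import Data.Integer as ℤ
open import Data.Integer using (+_)
import Data.Integer.Properties as ℤₚ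
open import Data.Integer.Solver using (module +-*-Solver)
import Data.Nat as ℕ
open import Data.Nat using (ℕ; zero; suc; pred; NonZero; _≤_; _<_; _≤?_; _<?_; _+_; _*_; _∸_; _^_; ∣_-_∣; z≤n; s≤s)
open import Data.Nat.DivMod using (_%_; m%n<n; m≡m%n+[m/n]*n)
open import Data.Nat.Properties
import Data.Nat.Solver as ℕSolver
open import Data.Product using (Σ; ∃; _×_; _,_; proj₁; proj₂)
import Data.Rational.Unnormalised as ℚ
open import Data.Rational.Unnormalised using (_/_)
open import Data.Sum using (_⊎_; inj₁; inj₂; [_,_]′)
open import Data.Unit using (⊤; tt)
open import Function.Base using (_∘_; id)
open import Function.Bundles using (Equivalence)
open import Function.Definitions using (Injective)
open import Level using (0ℓ)
open import Relation.Binary.Construct.Closure.ReflexiveTransitive using (Star; ε; _◅_; _◅◅_; reverse)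
open import Relation.Binary.Core using (Rel)
open import Relation.Binary.Definitions using (Decidable; Tri; tri<; tri≈; tri>)
open import Relation.Binary.PropositionalEquality
open import Relation.Binary.Structures using (IsStrictTotalOrder; IsEquivalence)
open import Relation.Nullary using (¬_; Dec; yes; no; contradiction)
open import Relation.Nullary.Decidable using (_×-dec_; _⊎-dec_; ¬?)
import Relation.Unary as U

-- Search and counting in finite sets

least : {P : ℕ → Set} → U.Decidable P → ∀ {k} → P k → ∃ λ m → P m × (∀ {j} → P j → m ≤ j)
least P? {k} pk with P? 0
least P? {k} pk       | yes p0 = 0 , p0 , λ _ → z≤n
least P? {zero} pk    | no ¬p0 = contradiction pk ¬p0
least {P} P? {suc k} pk | no ¬p0 with least (P? ∘ suc) pk
... | m , pm , min = suc m , pm , λ { {zero} p0 → contradiction p0 ¬p0 ; {suc j} pj → s≤s (min pj) }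

bounded : ∀ {n} (f : Fin n → ℕ) → ∃ λ D → ∀ i → f i ≤ D
bounded {zero}  f = 0 , λ ()
bounded {suc n} f with bounded (f ∘ suc)
... | D , f≤D = f zero + D , λ { zero → m≤m+n (f zero) D ; (suc i) → ≤-trans (f≤D i) (m≤n+m D (f zero)) }

module _ {n} {P : Fin n → Set} (P? : U.Decidable P) (f : Fin n → ℕ) where

  -- `k` bounds how often `f` can still increase below its bound `D`; each move to a larger value
  -- uses up one.
  climb : ∀ D k x → P x → (∀ y → f y ≤ D) → D ≤ f x + k → ∃ λ m → P m × (∀ y → P y → f y ≤ f m)
  climb D k x px f≤D D≤ with Finₚ.any? (λ y → P? y ×-dec (f x <? f y))
  ... | no ¬above = x , px , λ y py → ≮⇒≥ (λ x<y → ¬above (y , py , x<y))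
  climb D zero x px f≤D D≤ | yes (y , py , x<y) =
    contradiction (≤-trans x<y (≤-trans (f≤D y) (subst (D ≤_) (+-identityʳ (f x)) D≤))) (<-irrefl refl)
  climb D (suc k) x px f≤D D≤ | yes (y , py , x<y) =
    climb D k y py f≤D (≤-trans (subst (D ≤_) (+-suc (f x) k) D≤) (+-monoˡ-≤ k x<y))

  maximal : ∃ P → ∃ λ m → P m × (∀ y → P y → f y ≤ f m)
  maximal (x , px) with bounded f
  ... | D , f≤D = climb D D x px f≤D (m≤n+m D (f x))

count : ∀ {n} {P : Fin n → Set} → U.Decidable P → ℕ
count {zero}  P? = 0
count {suc n} P? with P? zero
... | yes _ = suc (count (P? ∘ suc))
... | no  _ = count (P? ∘ suc)

count≤n : ∀ {n} {P : Fin n → Set} (P? : U.Decidable P) → count P? ≤ n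
count≤n {zero}  P? = z≤n
count≤n {suc n} P? with P? zero
... | yes _ = s≤s (count≤n (P? ∘ suc))
... | no  _ = m≤n⇒m≤1+n (count≤n (P? ∘ suc))

count-none : ∀ {n} {P : Fin n → Set} (P? : U.Decidable P) → (∀ i → ¬ P i) → count P? ≡ 0
count-none {zero}  P? ¬p = refl
count-none {suc n} P? ¬p with P? zero
... | yes p = contradiction p (¬p zero)
... | no  _ = count-none (P? ∘ suc) (¬p ∘ suc)

count-some : ∀ {n} {P : Fin n → Set} (P? : U.Decidable P) {i} → P i → 0 < count P?
count-some {suc n} P? {i} p with P? zero
count-some {suc n} P? {i}     p | yes _  = s≤s z≤n
count-some {suc n} P? {zero}  p | no ¬p₀ = contradiction p ¬p₀
count-some {suc n} P? {suc i} p | no _   = count-some (P? ∘ suc) p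

count-disjoint : ∀ {n} {P Q R : Fin n → Set}
  (P? : U.Decidable P) (Q? : U.Decidable Q) (R? : U.Decidable R) →
  (∀ {i} → P i → R i) → (∀ {i} → Q i → R i) → (∀ {i} → P i → ¬ Q i) →
  count P? + count Q? ≤ count R?
count-disjoint {zero}  P? Q? R? P⊆R Q⊆R P∥Q = z≤n
count-disjoint {suc n} P? Q? R? P⊆R Q⊆R P∥Q
  with count-disjoint (P? ∘ suc) (Q? ∘ suc) (R? ∘ suc) P⊆R Q⊆R P∥Q | P? zero | Q? zero | R? zero
... | ih | yes p | yes q | _      = contradiction q (P∥Q p)
... | ih | yes p | no _  | yes _  = s≤s ih
... | ih | yes p | no _  | no ¬r  = contradiction (P⊆R p) ¬r
... | ih | no _  | yes q | no ¬r  = contradiction (Q⊆R q) ¬r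
... | ih | no _  | no _  | yes _  = m≤n⇒m≤1+n ih
... | ih | no _  | no _  | no _   = ih
... | ih | no _  | yes q | yes _  =
  subst (_≤ suc (count (R? ∘ suc))) (sym (+-suc (count (P? ∘ suc)) (count (Q? ∘ suc)))) (s≤s ih)

count-mono : ∀ {n} {P R : Fin n → Set} (P? : U.Decidable P) (R? : U.Decidable R) →
  (∀ {i} → P i → R i) → count P? ≤ count R?
count-mono P? R? P⊆R = m+n≤o⇒m≤o (count P?) (count-disjoint P? (λ _ → no id) R? P⊆R ⊥-elim (λ _ → id))

-- Rooted trees

record RootedTree (N : ℕ) : Set where
  field
    root         : Fin N
    parent       : Fin N → Fin N
    depth        : Fin N → ℕ
    depth-root   : depth root ≡ 0
    depth-parent : ∀ {z} → z ≢ root → depth z ≡ suc (depth (parent z))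

  up : ℕ → Fin N → Fin N
  up zero    z = z
  up (suc k) z = up k (parent z)

  -- For x deeper than z this says z ≡ x, so it is false.
  Anc : Fin N → Fin N → Set
  Anc x z = up (depth z ∸ depth x) z ≡ x

  anc? : Decidable Anc
  anc? x z = up (depth z ∸ depth x) z Finₚ.≟ x

  anc-refl : ∀ z → Anc z z
  anc-refl z rewrite n∸n≡0 (depth z) = refl

  anc-unique : ∀ {x y z} → Anc x z → Anc y z → depth x ≡ depth y → x ≡ y
  anc-unique {z = z} xz yz eq = trans (sym xz) (trans (cong (λ d → up (depth z ∸ d) z) eq) yz)

  anc-depth : ∀ {x z} → Anc x z → depth x ≤ depth z
  anc-depth {x} {z} xz with depth x ≤? depth z
  ... | yes x≤z = x≤z
  ... | no  x≰z rewrite m≤n⇒m∸n≡0 (<⇒≤ (≰⇒> x≰z)) = ≤-reflexive (cong depth (sym xz))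

  anc-child : ∀ {x z} → z ≢ root → Anc x (parent z) → Anc x z
  anc-child {x} {z} z≢r xp rewrite depth-parent z≢r | +-∸-assoc 1 (anc-depth {x} xp) = xp

  nonroot : ∀ {z k} → depth z ≡ suc k → z ≢ root
  nonroot eq refl with () ← trans (sym eq) depth-root

  anc-parent : ∀ {x z} → Anc x z → z ≢ x → z ≢ root × Anc x (parent z)
  anc-parent {x} {z} xz z≢x with depth z in eq
  ... | zero rewrite 0∸n≡0 (depth x) = contradiction xz z≢x
  ... | suc k with z≢r ← nonroot eq | depth x ≤? k
  ...   | yes x≤k rewrite +-∸-assoc 1 x≤k | suc-injective (trans (sym eq) (depth-parent z≢r)) = z≢r , xz
  ...   | no x≰k rewrite m≤n⇒m∸n≡0 (≰⇒> x≰k) = contradiction xz z≢x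

  anc-root : ∀ z → Anc root z
  anc-root z = go (depth z) refl
    where
    go : ∀ k {z} → depth z ≡ k → Anc root z
    go k {z} eq with z Finₚ.≟ root
    ... | yes refl = anc-refl root
    go zero    eq | no z≢r with () ← trans (sym eq) (depth-parent z≢r)
    go (suc k) eq | no z≢r = anc-child z≢r (go k (suc-injective (trans (sym (depth-parent z≢r)) eq)))

  depth-up : ∀ k {z} → k ≤ depth z → depth (up k z) ≡ depth z ∸ k
  depth-up zero    _ = refl
  depth-up (suc k) {z} k<z with depth z in eq
  ... | suc d with d≡ ← suc-injective (trans (sym eq) (depth-parent (nonroot eq))) =
    trans (depth-up k (subst (k ≤_) d≡ (≤-pred k<z))) (cong (_∸ k) (sym d≡))

  -- The component of the tree minus x that contains z, named by the child of
  -- x that lies in it, or by x itself for the component above x.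
  branch : Fin N → Fin N → Fin N
  branch x z with anc? x z
  ... | yes _ = up (depth z ∸ suc (depth x)) z
  ... | no  _ = x

  -- Both ends of the tree edge are descendants of `x`, or neither is. In the first case the climb
  -- towards `x` from the parent is the climb from `z` without its first step.
  branch-parent : ∀ {x z} → z ≢ root → z ≢ x → parent z ≢ x → branch x z ≡ branch x (parent z)
  branch-parent {x} {z} z≢r z≢x p≢x with anc? x z | anc? x (parent z)
  ... | no _   | no _   = refl
  ... | yes xz | no ¬xp = contradiction (proj₂ (anc-parent xz z≢x)) ¬xp
  ... | no ¬xz | yes xp = contradiction (anc-child z≢r xp) ¬xz
  ... | yes _  | yes xp with x<p ← ≤∧≢⇒< (anc-depth xp) (λ eq → p≢x (sym (anc-unique xp (anc-refl (parent z)) eq)))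
    rewrite depth-parent z≢r = cong (λ k → up k z) (+-∸-assoc 1 x<p)

  -- A label other than `x` comes from a climb that starts at a proper descendant of `x` and stops
  -- one level short of `x`.
  branch-below : ∀ {x y z} → branch x z ≡ y → y ≢ x → Anc y z × depth x < depth y
  branch-below {x} {y} {z} eq y≢x with anc? x z
  ... | no _ = contradiction (sym eq) y≢x
  ... | yes xz = anc , subst (depth x <_) (sym dy) ≤-refl
    where
    x<z : depth x < depth z
    x<z = ≤∧≢⇒< (anc-depth xz) λ x≡z → y≢x (begin
      y                               ≡⟨ eq ⟨
      up (depth z ∸ suc (depth x)) z  ≡⟨ cong (λ k → up k z) (m≤n⇒m∸n≡0 (≤-trans (≤-reflexive (sym x≡z)) (n≤1+n _))) ⟩
      z                               ≡⟨ anc-unique (anc-refl z) xz (sym x≡z) ⟩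
      x                               ∎)
      where open ≡-Reasoning
    dy : depth y ≡ suc (depth x)
    dy = trans (cong depth (sym eq)) (trans
      (depth-up (depth z ∸ suc (depth x)) (m∸n≤m _ (suc (depth x)))) (m∸[m∸n]≡n x<z))
    anc : Anc y z
    anc = trans (cong (λ d → up (depth z ∸ d) z) dy) eq

  -- From a proper descendant of `x` the climb would end one level deeper than `x`, so not at `x`.
  branch-above : ∀ {x z} → branch x z ≡ x → z ≢ x → ¬ Anc x z
  branch-above {x} {z} eq z≢x xz with anc? x z
  ... | no ¬xz = ¬xz xz
  ... | yes _ with z≢r , xp ← anc-parent xz z≢x = <-irrefl (cong depth (sym eq))
    (subst (depth x <_) (sym (trans (depth-up (depth z ∸ suc (depth x)) (m∸n≤m _ (suc (depth x))))
      (m∸[m∸n]≡n (subst (depth x <_) (sym (depth-parent z≢r)) (s≤s (anc-depth xp)))))) ≤-refl)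

-- Breadth-first search

module BFS {N} {R : Rel (Fin N) 0ℓ} (R? : Decidable R) (root : Fin N)
  (reach : ∀ x → Star R x root) where

  Walk : ℕ → Fin N → Set
  Walk zero    x = x ≡ root
  Walk (suc k) x = ∃ λ y → R x y × Walk k y

  walk? : ∀ k → U.Decidable (Walk k)
  walk? zero    x = x Finₚ.≟ root
  walk? (suc k) x = Finₚ.any? λ y → R? x y ×-dec walk? k y

  walk : ∀ {x} → Star R x root → ∃ λ k → Walk k x
  walk ε        = 0 , refl
  walk (r ◅ rs) with walk rs
  ... | k , w = suc k , _ , r , w

  abstract
    distance : ∀ x → ∃ λ k → Walk k x × (∀ {j} → Walk j x → k ≤ j)
    distance x = least (λ k → walk? k x) (proj₂ (walk (reach x)))

  depth : Fin N → ℕ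
  depth = proj₁ ∘ distance

  depth-min : ∀ {k x} → Walk k x → depth x ≤ k
  depth-min {x = x} = proj₂ (proj₂ (distance x))

  depth-root : depth root ≡ 0
  depth-root = n≤0⇒n≡0 (depth-min refl)

  depth-step : ∀ {x y} → R x y → depth x ≤ suc (depth y)
  depth-step {y = y} r = depth-min (y , r , proj₁ (proj₂ (distance y)))

  -- The second vertex of a shortest walk: the rest of the walk bounds its distance from above,
  -- `depth-step` from below.
  depth-parent : ∀ {x} → x ≢ root → ∃ λ y → R x y × depth x ≡ suc (depth y)
  depth-parent {x} x≢r with depth x in eq | proj₁ (proj₂ (distance x))
  ... | zero  | x≡r = contradiction x≡r x≢r
  ... | suc k | y , r , w = y , r , cong suc (≤-antisym (≤-pred (subst (_≤ _) eq (depth-step r))) (depth-min w))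

-- Layouts from separators

module Layouts {n} (Adj : Rel (Fin n) 0ℓ) (level : Fin n → ℕ) where

  -- Levels enter only through `separate`; `flat` and `monotone` concern positions at all levels at
  -- once. Together, `separate` and `flat` force an edge between distinct vertices of one colour to
  -- join different levels. The bound `K` lets layouts be stacked in blocks.
  record Layout (U : Fin n → Set) (c K : ℕ) : Set where
    field
      colour pos : Fin n → ℕ
      colour<    : ∀ {u} → U u → colour u < c
      pos<       : ∀ {u} → U u → pos u < K
      separate   : ∀ {u v} → U u → U v → level u ≡ level v → colour u ≡ colour v →
                   pos u ≡ pos v → u ≡ v
      flat       : ∀ {u w} → U u → U w → Adj u w → colour u ≡ colour w → pos u ≡ pos w
      monotone   : ∀ {u w v y} → U u → U w → U v → U y → Adj u w → Adj v y →
                   colour u ≡ colour v → colour w ≡ colour y → pos u < pos v → ¬ pos y < pos w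

  emptyLayout : ∀ {U c K} → (∀ u → ¬ U u) → Layout U c K
  emptyLayout none = record
    { colour   = λ _ → 0
    ; pos      = λ _ → 0
    ; colour<  = λ u∈U → contradiction u∈U (none _)
    ; pos<     = λ u∈U → contradiction u∈U (none _)
    ; separate = λ u∈U → contradiction u∈U (none _)
    ; flat     = λ u∈U → contradiction u∈U (none _)
    ; monotone = λ u∈U → contradiction u∈U (none _)
    }

  -- The vertices of the separator `B` get one colour for each index and position 0; `M-unique`
  -- keeps them apart by level. The pieces share the next `c` colours, and each piece has its own
  -- block of `K` positions.
  module Peel {U : Fin n → Set} {w c K N : ℕ} (0<K : 0 < K)
    (M : Fin w → Fin n → Set) (M? : ∀ i → U.Decidable (M i))
    (M-unique : ∀ {i u v} → M i u → M i v → level u ≡ level v → u ≡ v)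
    (label : Fin n → Fin N) where

    B : Fin n → Set
    B u = ∃ λ i → M i u

    B? : U.Decidable B
    B? u = Finₚ.any? λ i → M? i u

    Piece : Fin N → Fin n → Set
    Piece ℓ u = U u × ¬ B u × label u ≡ ℓ

    module _ (label-edge : ∀ {u v} → U u → U v → ¬ B u → ¬ B v → Adj u v → label u ≡ label v)
      (pieces : ∀ ℓ → Layout (Piece ℓ) c K) where

      module L (ℓ : Fin N) = Layout (pieces ℓ)

      colourOf : ∀ u → Dec (B u) → ℕ
      colourOf u (yes (i , _)) = toℕ i
      colourOf u (no _)        = w + Layout.colour (pieces (label u)) u

      posOf : ∀ u → Dec (B u) → ℕ
      posOf u (yes _) = 0
      posOf u (no _)  = toℕ (label u) * K + Layout.pos (pieces (label u)) u

      clash : {A : Set} {i : Fin w} {k : ℕ} → toℕ i ≡ w + k → A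
      clash {i = i} eq = contradiction (Finₚ.toℕ<n i) (≤⇒≯ (≤-trans (m≤m+n w _) (≤-reflexive (sym eq))))

      block< : ∀ {a b x y} → a < b → x < K → a * K + x < b * K + y
      block< {a} {b} {x} {y} a<b x<K = begin-strict
        a * K + x  <⟨ +-monoʳ-< (a * K) x<K ⟩
        a * K + K  ≡⟨ +-comm (a * K) K ⟩
        suc a * K  ≤⟨ *-monoˡ-≤ K a<b ⟩
        b * K      ≤⟨ m≤m+n (b * K) y ⟩
        b * K + y  ∎
        where open ≤-Reasoning

      colourOf< : ∀ {u} → U u → ∀ b → colourOf u b < w + c
      colourOf< u∈U (yes (i , _)) = <-≤-trans (Finₚ.toℕ<n i) (m≤m+n w c)
      colourOf< u∈U (no ¬b)       = +-monoʳ-< w (L.colour< _ (u∈U , ¬b , refl))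

      posOf< : ∀ {u} → U u → ∀ b → posOf u b < N * K
      posOf< {u} u∈U (no ¬b)
        with b< ← block< {y = 0} (Finₚ.toℕ<n (label u)) (L.pos< _ (u∈U , ¬b , refl)) =
        <-≤-trans b< (≤-reflexive (+-identityʳ (N * K)))
      posOf< {u} u∈U (yes _) = ≤-trans 0<K (≤-trans (m≤m+n K _) (*-monoˡ-≤ K (Finₚ.toℕ<n (label u))))

      -- The labels are variables of their own so that, once equal, they can be unified and the
      -- layout of a single piece applies.
      separatePieces : ∀ {ℓ ℓ′ u v} → Piece ℓ u → Piece ℓ′ v → level u ≡ level v →
        L.colour ℓ u ≡ L.colour ℓ′ v →
        toℕ ℓ * K + L.pos ℓ u ≡ toℕ ℓ′ * K + L.pos ℓ′ v → u ≡ v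
      separatePieces {ℓ} {ℓ′} p q lev col eq with Finₚ.<-cmp ℓ ℓ′
      ... | tri< ℓ<ℓ′ _ _ = contradiction eq (<⇒≢ (block< ℓ<ℓ′ (L.pos< ℓ p)))
      ... | tri> _ _ ℓ′<ℓ = contradiction (sym eq) (<⇒≢ (block< ℓ′<ℓ (L.pos< ℓ′ q)))
      ... | tri≈ _ refl _ = L.separate ℓ p q lev col (+-cancelˡ-≡ (toℕ ℓ * K) _ _ eq)

      separateOf : ∀ {u v} → U u → U v → ∀ b b′ → level u ≡ level v →
        colourOf u b ≡ colourOf v b′ → posOf u b ≡ posOf v b′ → u ≡ v
      separateOf u∈U v∈U (yes (i , m)) (yes (j , m′)) lev col eq
        with refl ← Finₚ.toℕ-injective col = M-unique m m′ lev
      separateOf u∈U v∈U (yes (i , m)) (no _) lev col eq = clash col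
      separateOf u∈U v∈U (no _) (yes (i , m)) lev col eq = clash (sym col)
      separateOf u∈U v∈U (no ¬b) (no ¬b′) lev col eq =
        separatePieces (u∈U , ¬b , refl) (v∈U , ¬b′ , refl) lev (+-cancelˡ-≡ w _ _ col) eq

      flatPieces : ∀ {ℓ ℓ′ u v} → Piece ℓ u → Piece ℓ′ v → Adj u v → ℓ ≡ ℓ′ →
        L.colour ℓ u ≡ L.colour ℓ′ v →
        toℕ ℓ * K + L.pos ℓ u ≡ toℕ ℓ′ * K + L.pos ℓ′ v
      flatPieces {ℓ} p q e refl col = cong (λ k → toℕ ℓ * K + k) (L.flat ℓ p q e col)

      flatOf : ∀ {u v} → U u → U v → ∀ b b′ → Adj u v →
        colourOf u b ≡ colourOf v b′ → posOf u b ≡ posOf v b′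
      flatOf u∈U v∈U (yes _) (yes _) e col = refl
      flatOf u∈U v∈U (yes (i , m)) (no _) e col = clash col
      flatOf u∈U v∈U (no _) (yes (i , m)) e col = clash (sym col)
      flatOf u∈U v∈U (no ¬b) (no ¬b′) e col =
        flatPieces (u∈U , ¬b , refl) (v∈U , ¬b′ , refl) e (label-edge u∈U v∈U ¬b ¬b′ e)
          (+-cancelˡ-≡ w _ _ col)

      -- Both ends of an edge lie in the same piece, and the blocks of two pieces come in the same
      -- order at either end; so a crossing could only occur inside one piece.
      monotonePieces : ∀ {ℓ₁ ℓ₂ ℓ₃ ℓ₄ u x v y} →
        Piece ℓ₁ u → Piece ℓ₂ x → Piece ℓ₃ v → Piece ℓ₄ y → Adj u x → Adj v y →
        ℓ₁ ≡ ℓ₂ → ℓ₃ ≡ ℓ₄ → L.colour ℓ₁ u ≡ L.colour ℓ₃ v → L.colour ℓ₂ x ≡ L.colour ℓ₄ y →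
        toℕ ℓ₁ * K + L.pos ℓ₁ u < toℕ ℓ₃ * K + L.pos ℓ₃ v →
        ¬ toℕ ℓ₄ * K + L.pos ℓ₄ y < toℕ ℓ₂ * K + L.pos ℓ₂ x
      monotonePieces {ℓ} {_} {ℓ′} pu px pv py e e′ refl refl col col′ u<v y<x with Finₚ.<-cmp ℓ ℓ′
      ... | tri< ℓ<ℓ′ _ _ = <-asym y<x (block< ℓ<ℓ′ (L.pos< ℓ px))
      ... | tri> _ _ ℓ′<ℓ = <-asym u<v (block< ℓ′<ℓ (L.pos< ℓ′ pv))
      ... | tri≈ _ refl _ = L.monotone ℓ pu px pv py e e′ col col′
        (+-cancelˡ-< (toℕ ℓ * K) _ _ u<v) (+-cancelˡ-< (toℕ ℓ * K) _ _ y<x)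

      -- The colour tells whether a vertex is in `B`. Two vertices of `B` both have position 0,
      -- which leaves no room for a strict inequality.
      monotoneOf : ∀ {u x v y} → U u → U x → U v → U y → ∀ bu bx bv by → Adj u x → Adj v y →
        colourOf u bu ≡ colourOf v bv → colourOf x bx ≡ colourOf y by →
        posOf u bu < posOf v bv → ¬ posOf y by < posOf x bx
      monotoneOf _ _ _ _ (yes _) _ (yes _) _ _ _ _ _ ()
      monotoneOf _ _ _ _ (yes (i , m)) _ (no _) _ _ _ col _ _ = clash col
      monotoneOf _ _ _ _ (no _) _ (yes (i , m)) _ _ _ col _ _ = clash (sym col)
      monotoneOf _ _ _ _ (no _) (yes _) (no _) (yes _) _ _ _ _ _ ()
      monotoneOf _ _ _ _ (no _) (yes (i , m)) (no _) (no _) _ _ _ col _ = clash col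
      monotoneOf _ _ _ _ (no _) (no _) (no _) (yes (i , m)) _ _ _ col _ = clash (sym col)
      monotoneOf u∈U x∈U v∈U y∈U (no ¬u) (no ¬x) (no ¬v) (no ¬y) e e′ col col′ =
        monotonePieces (u∈U , ¬u , refl) (x∈U , ¬x , refl) (v∈U , ¬v , refl) (y∈U , ¬y , refl) e e′
          (label-edge u∈U x∈U ¬u ¬x e) (label-edge v∈U y∈U ¬v ¬y e′)
          (+-cancelˡ-≡ w _ _ col) (+-cancelˡ-≡ w _ _ col′)

      peel : Layout U (w + c) (N * K)
      peel = record
        { colour   = λ u → colourOf u (B? u)
        ; pos      = λ u → posOf u (B? u)
        ; colour<  = λ {u} u∈U → colourOf< u∈U (B? u)
        ; pos<     = λ {u} u∈U → posOf< u∈U (B? u)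
        ; separate = λ {u} {v} u∈U v∈U → separateOf u∈U v∈U (B? u) (B? v)
        ; flat     = λ {u} {v} u∈U v∈U → flatOf u∈U v∈U (B? u) (B? v)
        ; monotone = λ {u} {x} {v} {y} u∈U x∈U v∈U y∈U →
            monotoneOf u∈U x∈U v∈U y∈U (B? u) (B? x) (B? v) (B? y)
        }

  -- M x is a separator of the vertices outside Z: an edge that avoids it has
  -- both homes in the same component of the tree minus x.
  module Separators {N w} (tree : RootedTree N) (home : Fin n → Fin N)
    (M : Fin N → Fin w → Fin n → Set) (M? : ∀ x i → U.Decidable (M x i))
    (M-unique : ∀ {x i u v} → M x i u → M x i v → level u ≡ level v → u ≡ v)
    (home∈M : ∀ u → ∃ λ i → M (home u) i u)
    (Z : Fin n → Set)
    (branch-edge : ∀ {x u v} → ¬ Z u → ¬ Z v → ¬ (∃ λ i → M x i u) → ¬ (∃ λ i → M x i v) →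
      Adj u v → RootedTree.branch tree x (home u) ≡ RootedTree.branch tree x (home v)) where

    open RootedTree tree

    -- Induction on `p`: the separator at a centroid costs `w` colours and leaves pieces of at most
    -- half the size, which share the colours of the later rounds. Each round multiplies the
    -- positions by `N`, one block for each label.
    layout : ∀ p {U : Fin n → Set} (U? : U.Decidable U) → (∀ {u} → U u → ¬ Z u) →
      count U? < 2 ^ p → Layout U (p * w) (N ^ p)
    layout zero    U? U∥Z small = emptyLayout λ u u∈U →
      contradiction (count-some U? u∈U) (≤⇒≯ (≤-pred small))
    layout (suc p) {U} U? U∥Z small = cases (count U? <? 2 * weight root)
      where
      below? : ∀ x → U.Decidable (λ u → U u × Anc x (home u))
      below? x u = U? u ×-dec anc? x (home u)

      weight : Fin N → ℕ
      weight x = count (below? x)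

      heavy? : U.Decidable (λ x → count U? < 2 * weight x)
      heavy? x = count U? <? 2 * weight x

      cases : Dec (count U? < 2 * weight root) → Layout U (suc p * w) (N ^ suc p)
      -- All homes are descendants of the root, so the root can be light only if `U` is empty.
      cases (no light) = emptyLayout λ u u∈U → light (begin-strict
        count U?           ≤⟨ count-mono U? (below? root) (λ {i} i∈U → i∈U , anc-root (home i)) ⟩
        weight root        <⟨ m<m+n (weight root) {weight root + 0}
                                (≤-trans (count-some (below? root) (u∈U , anc-root (home u))) (m≤m+n _ 0)) ⟩
        2 * weight root    ∎)
        where open ≤-Reasoning
      -- A deepest heavy node is a centroid: its children are light, and what is not in its subtree
      -- is the smaller part.
      cases (yes heavy) with maximal heavy? depth (root , heavy)
      ... | x , x-heavy , x-deepest =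
        peel (λ u∈U v∈U ¬u ¬v → branch-edge (U∥Z u∈U) (U∥Z v∈U) ¬u ¬v)
          λ ℓ → layout p (piece? ℓ) (λ u∈P → U∥Z (proj₁ u∈P)) (*-cancelˡ-< 2 _ _ (≤-<-trans (half ℓ) small))
        where
        instance
          N≢0 : NonZero N
          N≢0 = Finₚ.nonZeroIndex root
        open Peel {U = U} (m^n>0 N p) (M x) (M? x) M-unique (λ u → branch x (home u))

        piece? : ∀ ℓ → U.Decidable (Piece ℓ)
        piece? ℓ u = U? u ×-dec (¬? (B? u) ×-dec (branch x (home u) Finₚ.≟ ℓ))

        home≢x : ∀ {u} → ¬ B u → home u ≢ x
        home≢x ¬b refl = ¬b (home∈M _)

        half : ∀ ℓ → 2 * count (piece? ℓ) ≤ count U?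
        half ℓ with ℓ Finₚ.≟ x
        ... | yes refl = begin
          count (piece? ℓ) + (count (piece? ℓ) + 0)  ≡⟨ cong (λ k → count (piece? ℓ) + k) (+-identityʳ _) ⟩
          count (piece? ℓ) + count (piece? ℓ)        ≤⟨ +-monoʳ-≤ _ piece≤weight ⟩
          count (piece? ℓ) + weight x                ≤⟨ outside ⟩
          count U?                                   ∎
          where
          open ≤-Reasoning
          outside : count (piece? ℓ) + weight x ≤ count U?
          outside = count-disjoint (piece? ℓ) (below? x) U? proj₁ proj₁
            λ { (_ , ¬b , eq) (_ , anc) → branch-above eq (home≢x ¬b) anc }
          piece≤weight : count (piece? ℓ) ≤ weight x
          piece≤weight = +-cancelʳ-≤ (weight x) _ _ (≤-trans outside (<⇒≤
            (subst (λ k → count U? < weight x + k) (+-identityʳ (weight x)) x-heavy)))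
        ... | no ℓ≢x with Finₚ.any? (piece? ℓ)
        -- A label that no vertex has need not be a child of `x`, so nothing is known of its depth;
        -- but its piece is empty.
        ...   | no none rewrite count-none (piece? ℓ) (λ u u∈P → none (u , u∈P)) = z≤n
        ...   | yes (u , _ , _ , eq) = ≤-trans
          (*-monoʳ-≤ 2 (count-mono (piece? ℓ) (below? ℓ)
            λ { (u∈U , _ , eq′) → u∈U , proj₁ (branch-below eq′ ℓ≢x) }))
          (≮⇒≥ λ ℓ-heavy → <⇒≱ (proj₂ (branch-below eq ℓ≢x)) (x-deepest ℓ ℓ-heavy))

-- Orbits of two involutions

module Dihedral {N} {f g : Fin N → Fin N} (f-inv : Involutive _≡_ f) (g-inv : Involutive _≡_ g)
  (f-free : ∀ a → f a ≢ a) (g-free : ∀ a → g a ≢ a) where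

  -- The orbit is a cycle whose links alternate between `f` and `g`. The rotations are every second
  -- point of it, and their images under `f` are the others.
  rotate : Fin N → ℕ → Fin N
  rotate c zero    = c
  rotate c (suc i) = g (f (rotate c i))

  rotate-injective : ∀ {a b} → g (f a) ≡ g (f b) → a ≡ b
  rotate-injective {a} {b} eq = trans (sym (f-inv a)) (trans (cong f (trans (sym (g-inv (f a)))
    (trans (cong g eq) (g-inv (f b))))) (f-inv b))

  rotate-cancel : ∀ {c} i {d} → rotate c i ≡ rotate c (i + d) → c ≡ rotate c d
  rotate-cancel zero    eq = eq
  rotate-cancel (suc i) eq = rotate-cancel i (rotate-injective eq)

  -- Two of the first `N + 1` rotations agree by the pigeonhole principle, and cancelling the
  -- smaller exponent leaves a return to `c`.
  period : ∀ c → ∃ λ m → c ≡ rotate c (suc m)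
  period c with Finₚ.pigeonhole (n<1+n N) (λ i → rotate c (toℕ i))
  ... | i , j , i<j , eq = toℕ j ∸ suc (toℕ i) ,
    rotate-cancel (toℕ i) (trans eq (cong (rotate c) (sym (trans (+-suc (toℕ i) _) (m+[n∸m]≡n i<j)))))

  -- Undoing one rotation on the left and moving it to the right shrinks the gap by two. At gap 0
  -- the equation gives a fixed point of `f`, at gap 1 one of `g`.
  rotate≢flip : ∀ {c} i j → rotate c i ≢ f (rotate c j)
  rotate≢flip {c} i j = [ later , (λ i≤j eq → later i≤j (trans (sym (f-inv _)) (cong f (sym eq)))) ]′
    (≤-total j i)
    where
    ahead : ∀ d j → rotate c (d + j) ≢ f (rotate c j)
    ahead zero          j eq = f-free _ (sym eq)
    ahead (suc zero)    j eq = g-free _ eq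
    ahead (suc (suc d)) j eq = ahead d (suc j) (trans (cong (rotate c) (+-suc d j))
      (trans (sym (f-inv _)) (cong f (trans (sym (g-inv _)) (cong g eq)))))
    later : ∀ {i j} → j ≤ i → rotate c i ≢ f (rotate c j)
    later {i} {j} j≤i eq = ahead (i ∸ j) j (trans (cong (rotate c) (m∸n+n≡m j≤i)) eq)

  Hits : Fin N → Fin N → ℕ → Set
  Hits c a i = rotate c i ≡ a ⊎ rotate c i ≡ f a

  hits? : ∀ c a → U.Decidable (Hits c a)
  hits? c a i = (rotate c i Finₚ.≟ a) ⊎-dec (rotate c i Finₚ.≟ f a)

  hits-flip : ∀ {c a i} → Hits c a i → Hits c (f a) i
  hits-flip {a = a} (inj₁ eq) = inj₂ (trans eq (sym (f-inv a)))
  hits-flip         (inj₂ eq) = inj₁ eq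

  hits-turn : ∀ {c a i} → Hits c a i → ∃ (Hits c (g a))
  hits-turn {i = i} (inj₂ eq) = suc i , inj₁ (cong g (trans (cong f eq) (f-inv _)))
  hits-turn {i = suc i} (inj₁ eq) = i , inj₂ (trans (sym (f-inv _)) (cong f (trans (sym (g-inv _)) (cong g eq))))
  -- Here the rotation before `c` is needed; the period supplies it.
  hits-turn {c} {i = zero} (inj₁ refl) with period c
  ... | m , eq = m , inj₂ (trans (sym (f-inv _)) (cong f (trans (sym (g-inv _)) (cong g (sym eq)))))

  orbit-hits : ∀ {c a} → Orbit₂ f g c a → ∃ (Hits c a)
  orbit-hits {c} = go (0 , inj₁ refl)
    where
    go : ∀ {a b} → ∃ (Hits c a) → Orbit₂ f g a b → ∃ (Hits c b)
    go h ε = h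
    go (i , h) (inj₁ refl ◅ st) = go (i , hits-flip {c} {i = i} h) st
    go (i , h) (inj₂ refl ◅ st) = go (hits-turn {c} {i = i} h) st

-- Enumerations and injections

enumerate : ∀ {n} {P : Fin n → Set} → U.Decidable P → ∃ λ k → Σ (Fin k → Fin n) λ f →
  Injective _≡_ _≡_ f × (∀ i → P (f i)) × (∀ {x} → P x → ∃ λ i → f i ≡ x)
enumerate {zero}  P? = 0 , (λ ()) , (λ { {()} }) , (λ ()) , λ { {()} }
enumerate {suc n} {P} P? with enumerate (P? ∘ suc) | P? zero
... | k , f , f-inj , f∈P , f-onto | no ¬p = k , suc ∘ f , f-inj ∘ Finₚ.suc-injective , f∈P , onto
  where
  onto : ∀ {x} → P x → ∃ λ i → suc (f i) ≡ x
  onto {zero}  p = contradiction p ¬p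
  onto {suc x} p with f-onto p
  ... | i , refl = i , refl
... | k , f , f-inj , f∈P , f-onto | yes p₀ = suc k , f⁺ , inj , f⁺∈P , onto
  where
  f⁺ : Fin (suc k) → Fin (suc n)
  f⁺ zero    = zero
  f⁺ (suc i) = suc (f i)
  inj : Injective _≡_ _≡_ f⁺
  inj {zero}  {zero}  eq = refl
  inj {suc i} {suc j} eq = cong suc (f-inj (Finₚ.suc-injective eq))
  f⁺∈P : ∀ i → P (f⁺ i)
  f⁺∈P zero    = p₀
  f⁺∈P (suc i) = f∈P i
  onto : ∀ {x} → P x → ∃ λ i → f⁺ i ≡ x
  onto {zero}  p = zero , refl
  onto {suc x} p with f-onto p
  ... | i , refl = suc i , refl

others : ∀ {N} (r : Fin N) → ∃ λ m → N ≡ suc m × Σ (Fin m → Fin N) λ f →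
  Injective _≡_ _≡_ f × (∀ i → f i ≢ r)
others {suc m} r = m , refl , Fin.punchIn r , (λ {i} {j} → Finₚ.punchIn-injective r i j) , Finₚ.punchInᵢ≢i r

⊎-injective : ∀ {A : Set} {k m} {f : Fin k → A} {g : Fin m → A} →
  Injective _≡_ _≡_ f → Injective _≡_ _≡_ g → (∀ i j → f i ≢ g j) →
  Injective _≡_ _≡_ ([ f , g ]′ ∘ Fin.splitAt k)
⊎-injective {k = k} f-inj g-inj f∥g {x} {y} eq
  with Fin.splitAt k x in ex | Fin.splitAt k y in ey
... | inj₁ i | inj₂ j = contradiction eq (f∥g i j)
... | inj₂ i | inj₁ j = contradiction (sym eq) (f∥g j i)
... | inj₁ i | inj₁ j with refl ← f-inj eq =
  trans (sym (Finₚ.splitAt⁻¹-↑ˡ ex)) (Finₚ.splitAt⁻¹-↑ˡ ey)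
... | inj₂ i | inj₂ j with refl ← g-inj eq =
  trans (sym (Finₚ.splitAt⁻¹-↑ʳ ex)) (Finₚ.splitAt⁻¹-↑ʳ ey)

-- Tree and cotree of a surface

module Surface (S : CellularSurface) where

  open CellularSurface S

  Flag : Set
  Flag = Fin flags

  Edge Face : Set
  Edge = Fin (Classes.size edges)
  Face = Fin (Classes.size faces)

  edgeOf : Flag → Edge
  edgeOf = Classes.class edges

  faceOf : Flag → Face
  faceOf = Classes.class faces

  flagAt : Vertex → Flag
  flagAt x = proj₁ (Classes.class-surjective vertices x)

  vertex-flagAt : ∀ x → vertexOf (flagAt x) ≡ x
  vertex-flagAt x = proj₂ (Classes.class-surjective vertices x)

  same-class : ∀ {_∼_ : Rel Flag 0ℓ} (C : Classes _∼_) {a b} → b ∼ a → Classes.class C a ≡ Classes.class C b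
  same-class C a∼b = sym (Equivalence.from (Classes.class-≡⇔∼ C) a∼b)

  vertex-θ₁ : ∀ a → vertexOf (θ₁ a) ≡ vertexOf a
  vertex-θ₁ a = same-class vertices (inj₁ refl ◅ ε)

  vertex-θ₂ : ∀ a → vertexOf (θ₂ a) ≡ vertexOf a
  vertex-θ₂ a = same-class vertices (inj₂ refl ◅ ε)

  edge-θ₂ : ∀ a → edgeOf (θ₂ a) ≡ edgeOf a
  edge-θ₂ a = same-class edges (inj₂ refl ◅ ε)

  face-θ₀ : ∀ a → faceOf (θ₀ a) ≡ faceOf a
  face-θ₀ a = same-class faces (inj₁ refl ◅ ε)

  face-θ₁ : ∀ a → faceOf (θ₁ a) ≡ faceOf a
  face-θ₁ a = same-class faces (inj₂ refl ◅ ε)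

  -- As `θ₀` and `θ₂` are commuting involutions, these four flags exhaust their orbit: they are the
  -- flags of one edge.
  data Around (a : Flag) : Flag → Set where
    at       : Around a a
    along    : Around a (θ₀ a)
    across   : Around a (θ₂ a)
    opposite : Around a (θ₀ (θ₂ a))

  around-θ₀ : ∀ {a b} → Around a b → Around a (θ₀ b)
  around-θ₀ at = along
  around-θ₀ along = subst (Around _) (sym (θ₀-involutive _)) at
  around-θ₀ across = opposite
  around-θ₀ opposite = subst (Around _) (sym (θ₀-involutive _)) across

  around-θ₂ : ∀ {a b} → Around a b → Around a (θ₂ b)
  around-θ₂ at = across
  around-θ₂ along = subst (Around _) (θ₀θ₂-commute _) opposite
  around-θ₂ across = subst (Around _) (sym (θ₂-involutive _)) at
  around-θ₂ {a} opposite = subst (Around a)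
    (trans (cong θ₀ (sym (θ₂-involutive a))) (θ₀θ₂-commute (θ₂ a))) along

  around : ∀ {a b} → edgeOf a ≡ edgeOf b → Around a b
  around {a} eq = go at (Equivalence.to (Classes.class-≡⇔∼ edges) eq)
    where
    go : ∀ {b c} → Around a b → Orbit₂ θ₀ θ₂ b c → Around a c
    go ab ε = ab
    go ab (inj₁ refl ◅ st) = go (around-θ₀ ab) st
    go ab (inj₂ refl ◅ st) = go (around-θ₂ ab) st

  around-vertex : ∀ {a b} → Around a b → vertexOf b ≡ vertexOf a ⊎ vertexOf b ≡ vertexOf (θ₀ a)
  around-vertex at       = inj₁ refl
  around-vertex along    = inj₂ refl
  around-vertex across   = inj₁ (vertex-θ₂ _)
  around-vertex {a} opposite = inj₂ (trans (cong vertexOf (θ₀θ₂-commute a)) (vertex-θ₂ (θ₀ a)))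

  Joined : Rel Vertex 0ℓ
  Joined x y = ∃ λ a → vertexOf a ≡ x × vertexOf (θ₀ a) ≡ y

  joined? : Decidable Joined
  joined? x y = Finₚ.any? λ a → (vertexOf a Finₚ.≟ x) ×-dec (vertexOf (θ₀ a) Finₚ.≟ y)

  rootVertex : Vertex
  rootVertex = vertexOf someFlag

  vertices-connected : ∀ x → Star Joined x rootVertex
  vertices-connected x = subst (λ y → Star Joined y rootVertex) (vertex-flagAt x)
    (go (connected (flagAt x) someFlag))
    where
    go : ∀ {a b} → Star (λ c d → d ≡ θ₀ c ⊎ d ≡ θ₁ c ⊎ d ≡ θ₂ c) a b → Star Joined (vertexOf a) (vertexOf b)
    go ε = ε
    go {a} (inj₁ refl ◅ st) = (a , refl , refl) ◅ go st
    go {a} {b} (inj₂ (inj₁ refl) ◅ st) = subst (λ y → Star Joined y (vertexOf b)) (vertex-θ₁ a) (go st)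
    go {a} {b} (inj₂ (inj₂ refl) ◅ st) = subst (λ y → Star Joined y (vertexOf b)) (vertex-θ₂ a) (go st)

  module V = BFS joined? rootVertex vertices-connected

  abstract
    -- The chosen flag lies at `x` on the edge to its parent. The root has no such edge; its flag
    -- only marks where a walk around it starts.
    pickStem : ∀ x → ∃ λ a → vertexOf a ≡ x × (x ≢ rootVertex → V.depth x ≡ suc (V.depth (vertexOf (θ₀ a))))
    pickStem x with x Finₚ.≟ rootVertex
    ... | yes refl = someFlag , refl , λ r≢r → contradiction refl r≢r
    ... | no x≢r with V.depth-parent x≢r
    ...   | y , (a , refl , refl) , eq = a , refl , λ _ → eq

  stem : Vertex → Flag
  stem x = proj₁ (pickStem x)

  vertex-stem : ∀ x → vertexOf (stem x) ≡ x
  vertex-stem x = proj₁ (proj₂ (pickStem x))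

  tree : RootedTree (Classes.size vertices)
  tree = record
    { root         = rootVertex
    ; parent       = λ x → vertexOf (θ₀ (stem x))
    ; depth        = V.depth
    ; depth-root   = V.depth-root
    ; depth-parent = λ {x} → proj₂ (proj₂ (pickStem x))
    }

  module T = RootedTree tree

  InTree : Edge → Set
  InTree e = ∃ λ x → x ≢ rootVertex × edgeOf (stem x) ≡ e

  inTree? : U.Decidable InTree
  inTree? e = Finₚ.any? λ x → ¬? (x Finₚ.≟ rootVertex) ×-dec (edgeOf (stem x) Finₚ.≟ e)

  module VertexOrbit = Dihedral θ₁-involutive θ₂-involutive θ₁-free θ₂-free

  -- Walking around the tree above u crosses every edge at it except the stem
  -- of u, so this is one closed walk with at most one step missing.
  module Spread {_≈_ : Rel Flag 0ℓ} (≈-eq : IsEquivalence _≈_) (u : Vertex)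
    (≈-θ₀ : ∀ {a} → T.Anc u (vertexOf a) → a ≈ θ₀ a)
    (≈-θ₁ : ∀ {a} → T.Anc u (vertexOf a) → a ≈ θ₁ a)
    (≈-θ₂ : ∀ {a} → T.Anc u (vertexOf a) → ¬ InTree (edgeOf a) → a ≈ θ₂ a) where

    open IsEquivalence ≈-eq renaming (refl to ≈-refl; sym to ≈-sym; trans to ≈-trans)
    open VertexOrbit using (rotate; rotate≢flip; orbit-hits)

    ≈-reflexive : ∀ {a b} → a ≡ b → a ≈ b
    ≈-reflexive refl = ≈-refl

    at-vertex : ∀ {x y} → x ≡ y → T.Anc u x → T.Anc u y
    at-vertex refl ux = ux

    height : ∃ λ D → ∀ x → V.depth x ≤ D
    height = bounded V.depth

    vertex-rotate : ∀ {c} i → vertexOf (rotate c i) ≡ vertexOf c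
    vertex-rotate zero    = refl
    vertex-rotate (suc i) = trans (vertex-θ₂ _) (trans (vertex-θ₁ _) (vertex-rotate i))

    -- Induction on `k`, which bounds the height of the subtree at `x`. The rotation about `x`
    -- passes edges outside the tree by `≈-θ₂`, and the edge to a child by a detour around that
    -- child.
    around-stem : ∀ k {x} → T.Anc u x → proj₁ height ≤ V.depth x + k →
                  ∀ {a} → vertexOf a ≡ x → stem x ≈ a
    around-stem k {x} ux D≤ {a} va = [ (λ eq → ≈-trans (walk i) (≈-reflexive eq)) ,
        (λ eq → ≈-trans (walk i) (≈-trans (≈-reflexive eq) (≈-sym (≈-θ₁ (at-vertex (sym va) ux))))) ]′ hit
      where
      orbit : Orbit₂ θ₁ θ₂ (stem x) a
      orbit = Equivalence.to (Classes.class-≡⇔∼ vertices) (trans (vertex-stem x) (sym va))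
      i = proj₁ (orbit-hits orbit)
      hit = proj₂ (orbit-hits orbit)

      stem-cross : ∀ k {y} → T.parent y ≡ x → y ≢ rootVertex →
        proj₁ height ≤ V.depth x + k → stem y ≈ θ₂ (stem y)
      -- With no height left, a child would be deeper than the bound on all depths.
      stem-cross zero {y} refl y≢r D≤ = contradiction (≤-trans (proj₂ height y) D≤)
        (<⇒≱ (≤-reflexive (trans (cong suc (+-identityʳ (V.depth x))) (sym (T.depth-parent y≢r)))))
      stem-cross (suc k) {y} refl y≢r D≤ = around-stem k (T.anc-child y≢r ux)
        (≤-trans D≤ (≤-reflexive (trans (+-suc _ k) (cong (λ d → d + k) (sym (T.depth-parent y≢r))))))
        (trans (vertex-θ₂ (stem y)) (vertex-stem y))

      -- The detour goes along the edge to `y`, around `y` to the other side of the edge, and back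
      -- along it.
      child-cross : ∀ {y b} → y ≢ rootVertex → Around (stem y) b → vertexOf b ≡ x →
                    b ≢ stem x → b ≢ θ₂ (stem x) → b ≈ θ₂ b
      child-cross {y} y≢r at vb b≢ _ = contradiction (cong stem (trans (sym (vertex-stem y)) vb)) b≢
      child-cross {y} y≢r across vb _ b≢ =
        contradiction (cong (θ₂ ∘ stem) (trans (sym (vertex-stem y)) (trans (sym (vertex-θ₂ _)) vb))) b≢
      child-cross {y} y≢r along vb _ _ =
        ≈-trans (≈-sym (≈-θ₀ uy)) (≈-trans (stem-cross k vb y≢r D≤)
          (≈-trans (≈-θ₀ (at-vertex (sym (vertex-θ₂ _)) uy)) (≈-reflexive (θ₀θ₂-commute _))))
        where
        uy : T.Anc u (vertexOf (stem y))
        uy = at-vertex (sym (vertex-stem y)) (T.anc-child y≢r (at-vertex (sym vb) ux))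
      child-cross {y} y≢r opposite vb _ _ =
        ≈-trans (≈-sym (≈-θ₀ (at-vertex (sym (vertex-θ₂ _)) uy))) (≈-trans (≈-sym (stem-cross k vb′ y≢r D≤))
          (≈-trans (≈-θ₀ uy) (≈-reflexive (trans (cong θ₀ (sym (θ₂-involutive _))) (θ₀θ₂-commute _)))))
        where
        vb′ : T.parent y ≡ x
        vb′ = trans (sym (trans (cong vertexOf (θ₀θ₂-commute (stem y))) (vertex-θ₂ _))) vb
        uy : T.Anc u (vertexOf (stem y))
        uy = at-vertex (sym (vertex-stem y)) (T.anc-child y≢r (at-vertex (sym vb′) ux))

      cross : ∀ {b} → vertexOf b ≡ x → b ≢ stem x → b ≢ θ₂ (stem x) → b ≈ θ₂ b
      cross {b} vb b≢ b≢′ with inTree? (edgeOf b)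
      ... | no ∉T = ≈-θ₂ (at-vertex (sym vb) ux) ∉T
      ... | yes (y , y≢r , eq) = child-cross y≢r (around eq) vb b≢ b≢′

      walk : ∀ i → stem x ≈ rotate (stem x) i
      walk zero = ≈-refl
      -- The one edge not to be crossed is the stem of `x`. Its side `θ₂ (stem x)` is reached only
      -- when the next rotation is `stem x` again, and its side `stem x` never, by `rotate≢flip`.
      walk (suc i) with θ₁ (rotate (stem x) i) Finₚ.≟ θ₂ (stem x)
      ... | yes eq = ≈-reflexive (trans (sym (θ₂-involutive _)) (cong θ₂ (sym eq)))
      ... | no  ≢θ₂ = ≈-trans (walk i) (≈-trans (≈-θ₁ (at-vertex (sym vi) ux))
          (cross (trans (vertex-θ₁ _) vi) (λ eq → rotate≢flip 0 i (sym eq)) ≢θ₂))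
        where
        vi : vertexOf (rotate (stem x) i) ≡ x
        vi = trans (vertex-rotate i) (vertex-stem x)

    -- Induction on depth: `around-stem` leads from `a` to the stem of its vertex, and `θ₀` from
    -- there to a flag at the parent.
    descend : ∀ k {a} → V.depth (vertexOf a) ≡ k → T.Anc u (vertexOf a) → stem u ≈ a
    descend k {a} eq ua with vertexOf a Finₚ.≟ u
    ... | yes va≡u = around-stem (proj₁ height) (T.anc-refl u) (m≤n+m _ (V.depth u)) va≡u
    ... | no va≢u with T.anc-parent ua va≢u
    descend zero    eq ua | no va≢u | va≢r , _ with () ← trans (sym eq) (T.depth-parent va≢r)
    descend (suc k) {a} eq ua | no va≢u | va≢r , up =
      ≈-trans (descend k (suc-injective (trans (sym (T.depth-parent va≢r)) eq)) up)
        (≈-trans (≈-sym (≈-θ₀ (at-vertex (sym (vertex-stem _)) ua)))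
          (around-stem (proj₁ height) ua (m≤n+m _ (V.depth (vertexOf a))) refl))

    spread : ∀ {a b} → T.Anc u (vertexOf a) → T.Anc u (vertexOf b) → a ≈ b
    spread ua ub = ≈-trans (≈-sym (descend _ refl ua)) (descend _ refl ub)

  -- Spanning tree of the dual graph

  Adjacent : Rel Face 0ℓ
  Adjacent f f′ = ∃ λ a → faceOf a ≡ f × faceOf (θ₂ a) ≡ f′ × ¬ InTree (edgeOf a)

  adjacent? : Decidable Adjacent
  adjacent? f f′ = Finₚ.any? λ a →
    (faceOf a Finₚ.≟ f) ×-dec ((faceOf (θ₂ a) Finₚ.≟ f′) ×-dec ¬? (inTree? (edgeOf a)))

  adjacent-sym : ∀ {f f′} → Adjacent f f′ → Adjacent f′ f
  adjacent-sym (a , fa , fa′ , ∉T) =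
    θ₂ a , fa′ , trans (cong faceOf (θ₂-involutive a)) fa , subst (λ e → ¬ InTree e) (sym (edge-θ₂ a)) ∉T

  rootFace : Face
  rootFace = faceOf someFlag

  -- Every vertex descends from the root, so `Spread` reaches all flags; `θ₀` and `θ₁` keep the
  -- face, and `θ₂` across an edge outside the tree is a step of the dual graph.
  faces-connected : ∀ f → Star Adjacent f rootFace
  faces-connected f with Classes.class-surjective faces f
  ... | a , refl = spread (T.anc-root _) (T.anc-root _)
    where
    _≈_ : Rel Flag 0ℓ
    a ≈ b = Star Adjacent (faceOf a) (faceOf b)
    ≈-eq : IsEquivalence _≈_
    ≈-eq = record { refl = ε ; sym = reverse adjacent-sym ; trans = _◅◅_ }
    open Spread ≈-eq rootVertex
      (λ {a} _ → subst (Star Adjacent (faceOf a)) (sym (face-θ₀ a)) ε)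
      (λ {a} _ → subst (Star Adjacent (faceOf a)) (sym (face-θ₁ a)) ε)
      (λ {a} _ ∉T → (a , refl , refl , ∉T) ◅ ε)

  module F = BFS adjacent? rootFace faces-connected

  abstract
    -- The dual of the stem: a flag of `f` on the edge to its parent face. At the root face it only
    -- marks where the fan begins.
    pickGate : ∀ f → ∃ λ a → faceOf a ≡ f ×
      (f ≢ rootFace → ¬ InTree (edgeOf a) × F.depth f ≡ suc (F.depth (faceOf (θ₂ a))))
    pickGate f with f Finₚ.≟ rootFace
    ... | yes refl = someFlag , refl , λ r≢r → contradiction refl r≢r
    ... | no f≢r with F.depth-parent f≢r
    ...   | f′ , (a , refl , refl , ∉T) , eq = a , refl , λ _ → ∉T , eq

  gate : Face → Flag
  gate f = proj₁ (pickGate f)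

  face-gate : ∀ f → faceOf (gate f) ≡ f
  face-gate f = proj₁ (proj₂ (pickGate f))

  gate∉T : ∀ {f} → f ≢ rootFace → ¬ InTree (edgeOf (gate f))
  gate∉T f≢r = proj₁ (proj₂ (proj₂ (pickGate _)) f≢r)

  gate-depth : ∀ {f} → f ≢ rootFace → F.depth f ≡ suc (F.depth (faceOf (θ₂ (gate f))))
  gate-depth f≢r = proj₂ (proj₂ (proj₂ (pickGate _)) f≢r)

  InCotree : Edge → Set
  InCotree e = ∃ λ f → f ≢ rootFace × edgeOf (gate f) ≡ e

  inCotree? : U.Decidable InCotree
  inCotree? e = Finₚ.any? λ f → ¬? (f Finₚ.≟ rootFace) ×-dec (edgeOf (gate f) Finₚ.≟ e)

-- Tree decomposition into triangles

-- Each face is fanned into triangles, one for each of its sides, whose common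
-- apex is the corner at its gate.  A triangle is named by the one of its two
-- flags a and θ₀ a that is a rotation of the gate; the face contributes the
-- path of its triangles in the order of rotation, hung from the triangle on the
-- other side of the gate.
module Triangulation (S : CellularSurface) where

  open CellularSurface S
  open Surface S

  module FaceOrbit = Dihedral θ₀-involutive θ₁-involutive θ₀-free θ₁-free
  open FaceOrbit

  abstract
    -- The rotations of the gate recur periodically; the least index gives each triangle one place
    -- in the path of its face.
    pickIndex : ∀ a → ∃ λ i → Hits (gate (faceOf a)) a i × (∀ {j} → Hits (gate (faceOf a)) a j → i ≤ j)
    pickIndex a with orbit-hits (Equivalence.to (Classes.class-≡⇔∼ faces) (face-gate (faceOf a)))
    ... | i , hit = least (hits? (gate (faceOf a)) a) {i} hit

  index : Flag → ℕ
  index a = proj₁ (pickIndex a)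

  index-min : ∀ {a f i} → faceOf a ≡ f → Hits (gate f) a i → index a ≤ i
  index-min {a} refl = proj₂ (proj₂ (pickIndex a))

  triangle : Flag → Flag
  triangle a = rotate (gate (faceOf a)) (index a)

  triangle-flags : ∀ a → triangle a ≡ a ⊎ triangle a ≡ θ₀ a
  triangle-flags a = proj₁ (proj₂ (pickIndex a))

  index-θ₀≤ : ∀ a → index (θ₀ a) ≤ index a
  index-θ₀≤ a = index-min {i = index a} (face-θ₀ a) (hits-flip {i = index a} (triangle-flags a))

  index-θ₀ : ∀ a → index (θ₀ a) ≡ index a
  index-θ₀ a = ≤-antisym (index-θ₀≤ a)
    (≤-trans (≤-reflexive (cong index (sym (θ₀-involutive a)))) (index-θ₀≤ (θ₀ a)))

  triangle-θ₀ : ∀ a → triangle (θ₀ a) ≡ triangle a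
  triangle-θ₀ a = cong₂ rotate (cong gate (face-θ₀ a)) (index-θ₀ a)

  face-triangle : ∀ a → faceOf (triangle a) ≡ faceOf a
  face-triangle a = [ cong faceOf , (λ eq → trans (cong faceOf eq) (face-θ₀ a)) ]′ (triangle-flags a)

  face-rotate : ∀ {f} i → faceOf (rotate (gate f) i) ≡ f
  face-rotate zero    = face-gate _
  face-rotate (suc i) = trans (face-θ₁ _) (trans (face-θ₀ _) (face-rotate i))

  -- Of the two flags `a` and `θ₀ a` only one is a rotation of the gate, by `rotate≢flip`, so the
  -- name cannot be the other one.
  triangle-rotate : ∀ {f} i → triangle (rotate (gate f) i) ≡ rotate (gate f) i
  triangle-rotate {f} i with triangle-flags (rotate (gate f) i)
  ... | inj₁ eq = eq
  ... | inj₂ eq = contradiction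
    (trans (cong (λ f′ → rotate (gate f′) (index (rotate (gate f) i))) (sym (face-rotate i))) eq)
    (rotate≢flip (index (rotate (gate f) i)) i)

  index-gate : ∀ f → index (gate f) ≡ 0
  index-gate f = n≤0⇒n≡0 (index-min {i = 0} (face-gate f) (inj₁ refl))

  rootTriangle : Flag
  rootTriangle = gate rootFace

  parentAt : Face → ℕ → Flag
  parentAt f (suc i) = rotate (gate f) i
  parentAt f zero with f Finₚ.≟ rootFace
  ... | yes _ = rootTriangle
  ... | no _  = triangle (θ₂ (gate f))

  parent : Flag → Flag
  parent z = parentAt (faceOf z) (index z)

  parent-root : parent rootTriangle ≡ rootTriangle
  parent-root rewrite index-gate rootFace | face-gate rootFace with rootFace Finₚ.≟ rootFace
  ... | yes _  = refl
  ... | no r≢r = contradiction refl r≢r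

  parent-gate : ∀ {f} → f ≢ rootFace → parent (gate f) ≡ triangle (θ₂ (gate f))
  parent-gate {f} f≢r rewrite index-gate f | face-gate f with f Finₚ.≟ rootFace
  ... | yes f≡r = contradiction f≡r f≢r
  ... | no _    = refl

  -- Without the loop at the root this is the graph of `parent`, so the distance to the root in it
  -- is the depth in the tree.
  Below : Rel Flag 0ℓ
  Below z y = z ≢ rootTriangle × parent z ≡ y

  below? : Decidable Below
  below? z y = ¬? (z Finₚ.≟ rootTriangle) ×-dec (parent z Finₚ.≟ y)

  -- Lexicographic induction on the depth of the face and the index: parents lower the index until
  -- the gate, where the face gives way to a shallower one.
  reach : ∀ n i {z} → F.depth (faceOf z) ≤ n → index z ≤ i → Star Below z rootTriangle
  reach n i {z} d≤n z≤i with z Finₚ.≟ rootTriangle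
  ... | yes refl = ε
  ... | no z≢r with index z in ez
  reach n (suc i) {z} d≤n z≤i | no z≢r | suc k =
    (z≢r , cong (parentAt (faceOf z)) ez) ◅
    reach n i (≤-trans (≤-reflexive (cong F.depth (face-rotate k))) d≤n)
      (≤-trans (index-min {i = k} (face-rotate k) (inj₁ refl)) (≤-pred z≤i))
  ... | zero with faceOf z Finₚ.≟ rootFace in ef
  ...   | yes _ = (z≢r , trans (cong (parentAt (faceOf z)) ez) at-root) ◅ ε
    where
    at-root : parentAt (faceOf z) 0 ≡ rootTriangle
    at-root rewrite ef = refl
  reach zero    i {z} d≤n z≤i | no z≢r | zero | no f≢r =
    contradiction (subst (_≤ 0) (gate-depth f≢r) d≤n) λ ()
  reach (suc n) i {z} d≤n z≤i | no z≢r | zero | no f≢r =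
    (z≢r , trans (cong (parentAt (faceOf z)) ez) at-gate) ◅
    reach n _ (≤-trans (≤-reflexive (cong F.depth (face-triangle _)))
      (≤-pred (subst (_≤ suc n) (gate-depth f≢r) d≤n))) ≤-refl
    where
    at-gate : parentAt (faceOf z) 0 ≡ triangle (θ₂ (gate (faceOf z)))
    at-gate rewrite ef = refl

  module D = BFS below? rootTriangle (λ z → reach _ _ {z} ≤-refl ≤-refl)

  triangles : RootedTree flags
  triangles = record
    { root         = rootTriangle
    ; parent       = parent
    ; depth        = D.depth
    ; depth-root   = D.depth-root
    ; depth-parent = λ z≢r → depth-parent (D.depth-parent z≢r)
    }
    where
    depth-parent : ∀ {z} → (∃ λ y → Below z y × D.depth z ≡ suc (D.depth y)) →
      D.depth z ≡ suc (D.depth (parent z))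
    depth-parent (_ , (_ , refl) , eq) = eq

  open RootedTree triangles using (branch; branch-parent)

  -- Since the root triangle is its own parent, the link may also be the loop there.
  branch-link : ∀ {x a b} → parent a ≡ b → a ≢ x → b ≢ x → branch x a ≡ branch x b
  branch-link {a = a} refl a≢x b≢x with a Finₚ.≟ rootTriangle
  ... | yes refl = cong (branch _) (sym parent-root)
  ... | no a≢r = branch-parent a≢r a≢x b≢x

  -- A rotation other than the gate itself is preceded by a rotation whose image under `θ₀` is
  -- `θ₁ a`; that one names the triangle of `θ₁ a`.
  turn-back : ∀ a → triangle a ≡ a → a ≡ gate (faceOf a) ⊎ parent (triangle a) ≡ triangle (θ₁ a)
  turn-back a ta with index a in ea
  ... | zero  = inj₁ (sym ta)
  ... | suc k = inj₂ (trans (cong₂ parentAt face-same (trans (cong index ta) ea)) (sym next))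
    where
    face-same : faceOf (θ₁ (θ₀ (rotate (gate (faceOf a)) k))) ≡ faceOf a
    face-same = face-rotate (suc k)
    rotate-k : θ₀ (rotate (gate (faceOf a)) k) ≡ θ₁ a
    rotate-k = trans (sym (θ₁-involutive _)) (cong θ₁ ta)
    next : triangle (θ₁ a) ≡ rotate (gate (faceOf a)) k
    next with triangle-flags (θ₁ a)
    ... | inj₁ eq = contradiction (trans (cong (λ f → rotate (gate f) (index (θ₁ a))) (sym (face-θ₁ a)))
                      (trans eq (sym rotate-k))) (rotate≢flip (index (θ₁ a)) k)
    ... | inj₂ eq = trans eq (trans (cong θ₀ (sym rotate-k)) (θ₀-involutive _))

  -- The flags `a` and `θ₁ a` form a corner of the face. It is the apex of the fan, or else the two
  -- sides that meet there carry consecutive triangles.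
  corner : ∀ a → (a ≡ gate (faceOf a) ⊎ θ₁ a ≡ gate (faceOf a)) ⊎
                 (parent (triangle a) ≡ triangle (θ₁ a) ⊎ parent (triangle (θ₁ a)) ≡ triangle a)
  corner a with triangle-flags a
  ... | inj₁ ta = [ inj₁ ∘ inj₁ , inj₂ ∘ inj₁ ]′ (turn-back a ta)
  ... | inj₂ ta = [ (λ eq → inj₁ (inj₂ (trans eq (cong gate (face-θ₁ a))))) ,
                    (λ eq → inj₂ (inj₂ (trans eq (cong triangle (θ₁-involutive a))))) ]′ (turn-back (θ₁ a) next)
    where
    θ₁a : θ₁ a ≡ rotate (gate (faceOf a)) (suc (index a))
    θ₁a = cong θ₁ (trans (sym (θ₀-involutive a)) (cong θ₀ (sym ta)))
    next : triangle (θ₁ a) ≡ θ₁ a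
    next = trans (cong triangle θ₁a) (trans (triangle-rotate (suc (index a))) (sym θ₁a))

  -- Bags and missed edges

  corners : Flag → Fin 3 → Vertex
  corners x zero             = vertexOf x
  corners x (suc zero)       = vertexOf (θ₀ x)
  corners x (suc (suc zero)) = vertexOf (gate (faceOf x))

  Extra : Edge → Set
  Extra e = ¬ InTree e × ¬ InCotree e

  extra? : U.Decidable Extra
  extra? e = ¬? (inTree? e) ×-dec ¬? (inCotree? e)

  extras : ℕ
  extras = proj₁ (enumerate extra?)

  extra : Fin extras → Edge
  extra = proj₁ (proj₂ (enumerate extra?))

  flagOn : Edge → Flag
  flagOn e = proj₁ (Classes.class-surjective edges e)

  extraEnds : Fin (extras + extras) → Vertex
  extraEnds = [ vertexOf ∘ flagOn ∘ extra , vertexOf ∘ θ₀ ∘ flagOn ∘ extra ]′ ∘ Fin.splitAt extras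

  extra-end : ∀ {a} → Extra (edgeOf a) → ∃ λ i → extraEnds i ≡ vertexOf a
  extra-end {a} ex with proj₂ (proj₂ (proj₂ (proj₂ (enumerate extra?)))) ex
  ... | i , eq with around-vertex (around (trans (proj₂ (Classes.class-surjective edges (extra i))) eq))
  ...   | inj₁ va = i Fin.↑ˡ extras , trans (cong [ _ , _ ]′ (Finₚ.splitAt-↑ˡ extras i extras)) (sym va)
  ...   | inj₂ va = extras Fin.↑ʳ i , trans (cong [ _ , _ ]′ (Finₚ.splitAt-↑ʳ extras extras i)) (sym va)

  -- As `u` is no ancestor of a corner of `x`, a triangle with a corner descended from `u` is not
  -- `x`. So `Spread` over the descendants of `u` applies to `Same`: each of its steps stays in a
  -- triangle or follows links that `x` does not cut.
  module _ {x : Flag} {u : Vertex} (u∉Z : ¬ ∃ λ i → T.Anc u (extraEnds i))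
    (u∉x : ¬ ∃ λ i → T.Anc u (corners x i)) where

    Same : Rel Flag 0ℓ
    Same a b = branch x (triangle a) ≡ branch x (triangle b)

    at-vertex : ∀ {v w} → v ≡ w → T.Anc u v → T.Anc u w
    at-vertex refl uv = uv

    triangle≢x : ∀ {a} → T.Anc u (vertexOf a) → triangle a ≢ x
    triangle≢x {a} ua refl with triangle-flags a
    ... | inj₁ eq = u∉x (zero , at-vertex (cong vertexOf (sym eq)) ua)
    ... | inj₂ eq = u∉x (suc zero , at-vertex (cong vertexOf (sym (trans (cong θ₀ eq) (θ₀-involutive a)))) ua)

    fan≢x : ∀ {a f} → T.Anc u (vertexOf (gate f)) → faceOf a ≡ f → triangle a ≢ x
    fan≢x {a} uf refl refl = u∉x (suc (suc zero) , at-vertex (cong (vertexOf ∘ gate) (sym (face-triangle a))) uf)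

    -- All triangles of the face have the apex as a corner, so `x` is none of them and their path is
    -- not cut.
    fan : ∀ {f} → T.Anc u (vertexOf (gate f)) → ∀ i → Same (rotate (gate f) i) (gate f)
    fan uf zero    = refl
    fan {f} uf (suc i) with turn-back (rotate (gate f) (suc i)) (triangle-rotate (suc i))
    ... | inj₁ eq = cong (branch x ∘ triangle) (trans eq (cong gate (face-rotate (suc i))))
    ... | inj₂ eq = trans (branch-link eq (fan≢x uf (face-rotate (suc i)))
        (fan≢x uf (trans (face-θ₁ _) (face-rotate (suc i)))))
      (trans (cong (branch x) (trans (cong triangle (θ₁-involutive _)) (triangle-θ₀ _))) (fan uf i))

    fan-any : ∀ {f a} → T.Anc u (vertexOf (gate f)) → faceOf a ≡ f → Same a (gate f)
    fan-any {a = a} uf refl = trans (cong (branch x) (sym (triangle-rotate (index a)))) (fan uf (index a))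

    same-θ₁ : ∀ {a} → T.Anc u (vertexOf a) → Same a (θ₁ a)
    same-θ₁ {a} ua with corner a
    -- At the apex the two triangles may be far apart in the path of the face, so the whole fan is
    -- used.
    ... | inj₁ apex = trans (fan-any gate∈u refl) (sym (fan-any gate∈u (face-θ₁ a)))
      where
      gate∈u : T.Anc u (vertexOf (gate (faceOf a)))
      gate∈u = [ (λ eq → at-vertex (cong vertexOf eq) ua) ,
                 (λ eq → at-vertex (trans (sym (vertex-θ₁ a)) (cong vertexOf eq)) ua) ]′ apex
    ... | inj₂ (inj₁ eq) = branch-link eq (triangle≢x ua) (triangle≢x (at-vertex (sym (vertex-θ₁ a)) ua))
    ... | inj₂ (inj₂ eq) = sym (branch-link eq (triangle≢x (at-vertex (sym (vertex-θ₁ a)) ua)) (triangle≢x ua))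

    -- The triangle at the gate hangs from the one across it. The four flags of the edge name only
    -- these two triangles, so each case is that link or its reverse.
    same-gate : ∀ {f a} → f ≢ rootFace → Around (gate f) a →
      triangle a ≢ x → triangle (θ₂ a) ≢ x → Same a (θ₂ a)
    same-gate {f} f≢r ar a≢x b≢x = go ar a≢x b≢x
      where
      g = gate f
      link : parent (triangle g) ≡ triangle (θ₂ g)
      link = trans (cong parent (triangle-rotate 0)) (parent-gate f≢r)
      forth : ∀ {a b} → triangle a ≡ triangle g → triangle b ≡ triangle (θ₂ g) →
              triangle a ≢ x → triangle b ≢ x → Same a b
      forth ea eb = branch-link (trans (cong parent ea) (trans link (sym eb)))
      θ₂θ₀ : ∀ c → triangle (θ₂ (θ₀ c)) ≡ triangle (θ₂ c)
      θ₂θ₀ c = trans (cong triangle (sym (θ₀θ₂-commute c))) (triangle-θ₀ (θ₂ c))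
      θ₂θ₂ : triangle (θ₂ (θ₂ g)) ≡ triangle g
      θ₂θ₂ = cong triangle (θ₂-involutive g)
      go : ∀ {a} → Around g a → triangle a ≢ x → triangle (θ₂ a) ≢ x → Same a (θ₂ a)
      go at       a≢x b≢x = forth refl refl a≢x b≢x
      go along    a≢x b≢x = forth (triangle-θ₀ g) (θ₂θ₀ g) a≢x b≢x
      go across   a≢x b≢x = sym (forth θ₂θ₂ refl b≢x a≢x)
      go opposite a≢x b≢x = sym (forth (trans (θ₂θ₀ (θ₂ g)) θ₂θ₂) (triangle-θ₀ (θ₂ g)) b≢x a≢x)

    same-θ₂ : ∀ {a} → T.Anc u (vertexOf a) → ¬ InTree (edgeOf a) → Same a (θ₂ a)
    same-θ₂ {a} ua ∉T with inCotree? (edgeOf a)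
    ... | yes (f , f≢r , eq) =
      same-gate f≢r (around eq) (triangle≢x ua) (triangle≢x (at-vertex (sym (vertex-θ₂ a)) ua))
    -- An edge missed by both trees would have an end descended from `u`, contrary to `u∉Z`.
    ... | no ∉C with extra-end (∉T , ∉C)
    ...   | i , eq = contradiction (i , at-vertex (sym eq) ua) u∉Z

    same-branch : ∀ {a b} → T.Anc u (vertexOf a) → T.Anc u (vertexOf b) → Same a b
    same-branch = Spread.spread {Same} (record { refl = refl ; sym = sym ; trans = trans }) u
      (λ {a} _ → cong (branch x) (sym (triangle-θ₀ a))) same-θ₁ same-θ₂

  -- Two distinct vertices with the same stem edge would be each other's parents, and each would be
  -- deeper than the other.
  stem-unique : ∀ {v w} → v ≢ rootVertex → w ≢ rootVertex → edgeOf (stem v) ≡ edgeOf (stem w) → v ≡ w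
  stem-unique {v} {w} v≢r w≢r eq with around-vertex (around eq) | around-vertex (around (sym eq))
  ... | inj₁ same | _ = trans (sym (vertex-stem v)) (trans (sym same) (vertex-stem w))
  ... | inj₂ _ | inj₁ same = trans (sym (vertex-stem v)) (trans same (vertex-stem w))
  ... | inj₂ w-above | inj₂ v-above = contradiction
    (≤-trans (≤-reflexive (sym (T.depth-parent w≢r)))
      (≤-reflexive (cong V.depth (trans (sym (vertex-stem w)) w-above))))
    (<⇒≱ (s≤s (≤-trans (n≤1+n _) (≤-reflexive (trans (sym (T.depth-parent v≢r))
      (cong V.depth (trans (sym (vertex-stem v)) v-above)))))))

  -- As for stems: two distinct faces with the same gate edge would be each other's parents.
  gate-unique : ∀ {f f′} → f ≢ rootFace → f′ ≢ rootFace → edgeOf (gate f) ≡ edgeOf (gate f′) → f ≡ f′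
  gate-unique {f} {f′} f≢r f′≢r eq with around-face (around eq) | around-face (around (sym eq))
    where
    around-face : ∀ {a b} → Around a b → faceOf b ≡ faceOf a ⊎ faceOf b ≡ faceOf (θ₂ a)
    around-face at       = inj₁ refl
    around-face along    = inj₁ (face-θ₀ _)
    around-face across   = inj₂ refl
    around-face opposite = inj₂ (face-θ₀ _)
  ... | inj₁ same | _ = trans (sym (face-gate f)) (trans (sym same) (face-gate f′))
  ... | inj₂ _ | inj₁ same = trans (sym (face-gate f)) (trans same (face-gate f′))
  ... | inj₂ up′ | inj₂ up = contradiction
      (≤-trans (≤-reflexive (sym (gate-depth f′≢r)))
        (≤-reflexive (cong F.depth (trans (sym (face-gate f′)) up′))))
      (<⇒≱ (s≤s (≤-trans (n≤1+n _) (≤-reflexive (trans (sym (gate-depth f≢r))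
        (cong F.depth (trans (sym (face-gate f)) up)))))))

  euler-count : ∀ m e l {g} → + 2 ℤ.- (+ suc m ℤ.- + e ℤ.+ + suc l) ≡ + g → e ≡ g + (m + l)
  euler-count m e l {g} χ = ℤₚ.+-injective (begin
    + e  ≡⟨ solve 3 (λ m e l → e := con (+ 2) :- (con (+ 1) :+ m :- e :+ (con (+ 1) :+ l)) :+ (m :+ l))
              refl (+ m) (+ e) (+ l) ⟩
    + 2 ℤ.- (+ suc m ℤ.- + e ℤ.+ + suc l) ℤ.+ (+ m ℤ.+ + l)  ≡⟨ cong (λ k → k ℤ.+ (+ m ℤ.+ + l)) χ ⟩
    + (g + (m + l))  ∎)
    where
    open ≡-Reasoning
    open +-*-Solver

  -- Missed edges, `m` stems and `l` gates are distinct edges, where the surface has `m + 1`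
  -- vertices and `l + 1` faces; Euler's formula counts `g + (m + l)` edges in all.
  extras-genus : ∀ {g} → eulerGenus ≡ + g → extras ≤ g
  extras-genus {g} χ with others rootVertex | others rootFace
  ... | m , V≡ , v , v-inj , v≢r | l , F≡ , f , f-inj , f≢r = +-cancelʳ-≤ (m + l) extras g (≤-trans
      (≤-trans (≤-reflexive (sym (+-assoc extras m l))) edges≤) (≤-reflexive E≡))
    where
    E = Classes.size edges
    edges≤ : extras + m + l ≤ E
    edges≤ = Finₚ.injective⇒≤ (⊎-injective
      (⊎-injective (proj₁ (proj₂ (proj₂ (enumerate extra?)))) (λ eq → v-inj (stem-unique (v≢r _) (v≢r _) eq))
        (λ i j eq → proj₁ (extra-isExtra i) (v j , v≢r j , sym eq)))
      (λ eq → f-inj (gate-unique (f≢r _) (f≢r _) eq)) disjoint)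
      where
      extra-isExtra : ∀ i → Extra (extra i)
      extra-isExtra = proj₁ (proj₂ (proj₂ (proj₂ (enumerate extra?))))
      disjoint : ∀ i j → [ extra , edgeOf ∘ stem ∘ v ]′ (Fin.splitAt extras i) ≢ edgeOf (gate (f j))
      disjoint i j eq with Fin.splitAt extras i
      ... | inj₁ k = proj₂ (extra-isExtra k) (f j , f≢r j , sym eq)
      ... | inj₂ k = gate∉T (f≢r j) (v k , v≢r k , eq)
    E≡ : E ≡ g + (m + l)
    E≡ = euler-count m E l (subst₂ (λ V F → + 2 ℤ.- (+ V ℤ.- + E ℤ.+ + F) ≡ + g) V≡ F≡ χ)

-- Track and queue layouts

module Tracks {n} (G : Graph n) (level : Fin n → ℕ)
  (level-edge : ∀ {u v} → Graph.Adj G u v → level u ≤ suc (level v)) where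

  open Graph G
  open Layouts Adj level

  congruent-gap : ∀ {a b} → a % 3 ≡ b % 3 → a < b → 3 + a ≤ b
  congruent-gap {a} {b} eq a<b = begin
    3 + a                             ≡⟨ cong (λ k → 3 + k) (m≡m%n+[m/n]*n a 3) ⟩
    3 + (a % 3 + (a ℕ./ 3) * 3)       ≡⟨ solve 2 (λ r q → con 3 :+ (r :+ q) := r :+ (con 3 :+ q))
                                           refl (a % 3) ((a ℕ./ 3) * 3) ⟩
    a % 3 + suc (a ℕ./ 3) * 3         ≤⟨ +-monoʳ-≤ (a % 3) (*-monoˡ-≤ 3 quotient<) ⟩
    a % 3 + (b ℕ./ 3) * 3             ≡⟨ cong (λ r → r + (b ℕ./ 3) * 3) eq ⟩
    b % 3 + (b ℕ./ 3) * 3             ≡⟨ m≡m%n+[m/n]*n b 3 ⟨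
    b                                 ∎
    where
    open ≤-Reasoning
    open ℕSolver.+-*-Solver
    quotient< : a ℕ./ 3 < b ℕ./ 3
    quotient< = ≰⇒> λ b≤a → <⇒≱ a<b (subst₂ _≤_ (sym (m≡m%n+[m/n]*n b 3)) (sym (m≡m%n+[m/n]*n a 3))
      (+-mono-≤ (≤-reflexive (sym eq)) (*-monoˡ-≤ 3 b≤a)))

  -- If `level u` were smaller, it would be smaller by at least 3; but the path from `v` through `y`
  -- and `w` to `u` allows a rise of at most 1 on each edge, so at most 2.
  congruent-levels : ∀ {u w v y} → Adj w u → Adj v y → level u % 3 ≡ level v % 3 →
    level u ≤ level v → level y ≤ level w → level u ≡ level v
  congruent-levels {u} {w} {v} {y} e e′ eq u≤v y≤w with m≤n⇒m<n∨m≡n u≤v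
  ... | inj₂ u≡v = u≡v
  ... | inj₁ u<v = contradiction (begin-strict
    level u              <⟨ n<1+n (level u) ⟩
    suc (level u)        ≤⟨ ≤-pred (≤-pred (≤-trans (congruent-gap eq u<v) v≤2+u)) ⟩
    level u              ∎) (<-irrefl refl)
    where
    open ≤-Reasoning
    v≤2+u : level v ≤ 2 + level u
    v≤2+u = ≤-trans (level-edge e′) (s≤s (≤-trans y≤w (level-edge e)))

  module _ {c K} (layout : Layout (λ _ → ⊤) c K) where

    open Layout layout

    trackOf : Fin n → Fin (c * 3)
    trackOf v = Fin.combine (fromℕ< (colour< {v} tt)) (fromℕ< (m%n<n (level v) 3))

    trackOf-injective : ∀ {v w} → trackOf v ≡ trackOf w → colour v ≡ colour w × level v % 3 ≡ level w % 3
    trackOf-injective {v} {w} eq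
      with Finₚ.combine-injective (fromℕ< (colour< {v} tt)) _ (fromℕ< (colour< {w} tt)) _ eq
    ... | eq₁ , eq₂ = Finₚ.fromℕ<-injective _ _ (colour< tt) (colour< tt) eq₁ ,
                      Finₚ.fromℕ<-injective _ _ (m%n<n (level v) 3) (m%n<n (level w) 3) eq₂

    _⊏_ : Rel (Fin n) 0ℓ
    v ⊏ w = level v < level w ⊎ (level v ≡ level w × pos v < pos w)

    ⊏-irrefl : ∀ {v} → ¬ v ⊏ v
    ⊏-irrefl (inj₁ v<v)       = <-irrefl refl v<v
    ⊏-irrefl (inj₂ (_ , v<v)) = <-irrefl refl v<v

    ⊏-trans : ∀ {u v w} → u ⊏ v → v ⊏ w → u ⊏ w
    ⊏-trans (inj₁ u<v) (inj₁ v<w) = inj₁ (<-trans u<v v<w)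
    ⊏-trans (inj₁ u<v) (inj₂ (v≡w , _)) = inj₁ (<-≤-trans u<v (≤-reflexive v≡w))
    ⊏-trans (inj₂ (u≡v , _)) (inj₁ v<w) = inj₁ (≤-<-trans (≤-reflexive u≡v) v<w)
    ⊏-trans (inj₂ (u≡v , u<v)) (inj₂ (v≡w , v<w)) = inj₂ (trans u≡v v≡w , <-trans u<v v<w)

    ⊏-level : ∀ {v w} → v ⊏ w → level v ≤ level w
    ⊏-level (inj₁ v<w)       = <⇒≤ v<w
    ⊏-level (inj₂ (v≡w , _)) = ≤-reflexive v≡w

    ⊏-pos : ∀ {v w} → v ⊏ w → level v ≡ level w → pos v < pos w
    ⊏-pos (inj₁ v<w)       v≡w = contradiction v≡w (<⇒≢ v<w)
    ⊏-pos (inj₂ (_ , v<w)) _   = v<w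

    ⊏-compare : ∀ v w → trackOf v ≡ trackOf w → v ⊏ w ⊎ v ≡ w ⊎ w ⊏ v
    ⊏-compare v w eq with <-cmp (level v) (level w)
    ... | tri< v<w _ _ = inj₁ (inj₁ v<w)
    ... | tri> _ _ w<v = inj₂ (inj₂ (inj₁ w<v))
    ... | tri≈ _ v≡w _ with <-cmp (pos v) (pos w)
    ...   | tri< v<w _ _ = inj₁ (inj₂ (v≡w , v<w))
    ...   | tri> _ _ w<v = inj₂ (inj₂ (inj₂ (sym v≡w , w<v)))
    ...   | tri≈ _ p≡ _ = inj₂ (inj₁ (separate tt tt v≡w (proj₁ (trackOf-injective eq)) p≡))

    trackOf-proper : ∀ {v w} → Adj v w → trackOf v ≢ trackOf w
    trackOf-proper {v} {w} e eq with trackOf-injective eq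
    ... | col , lev = irreflexive (separate tt tt level≡ col (flat tt tt e col)) e
      where
      level≡ : level v ≡ level w
      -- One edge plays both roles in `congruent-levels`.
      level≡ with ≤-total (level v) (level w)
      ... | inj₁ v≤w = congruent-levels (symmetric e) (symmetric e) lev v≤w v≤w
      ... | inj₂ w≤v = sym (congruent-levels e e (sym lev) w≤v w≤v)

    trackAssignment : TrackAssignment G (c * 3)
    trackAssignment = record
      { track  = trackOf
      ; proper = trackOf-proper
      ; _≺_    = λ v w → proj₁ v ⊏ proj₁ w
      ; isStrictTotalOrder = λ i → record
        { isStrictPartialOrder = record
          { isEquivalence = record { refl = refl ; sym = sym ; trans = trans }
          ; irrefl        = λ { refl → ⊏-irrefl }
          ; trans         = ⊏-trans
          ; <-resp-≈      = (λ { refl v⊏w → v⊏w }) , λ { refl v⊏w → v⊏w }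
          }
        ; compare = λ { (v , v∈) (w , w∈) → compare (⊏-compare v w (trans v∈ (sym w∈))) }
        }
      }
      where
      compare : ∀ {v w} → v ⊏ w ⊎ v ≡ w ⊎ w ⊏ v → Tri (v ⊏ w) (v ≡ w) (w ⊏ v)
      compare (inj₁ v⊏w)        = tri< v⊏w (λ { refl → ⊏-irrefl v⊏w }) (λ w⊏v → ⊏-irrefl (⊏-trans v⊏w w⊏v))
      compare (inj₂ (inj₁ refl)) = tri≈ ⊏-irrefl refl ⊏-irrefl
      compare (inj₂ (inj₂ w⊏v)) = tri> (λ v⊏w → ⊏-irrefl (⊏-trans v⊏w w⊏v)) (λ { refl → ⊏-irrefl w⊏v }) w⊏v

    trackLayout : TrackLayout G (c * 3)
    trackLayout = trackAssignment ,
      λ { (i , j , _ , (v , v∈i) , (x , x∈i) , (w , w∈j) , (y , y∈j) , vw , xy , v⊏x , y⊏w) →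
        noCrossing (trackOf-injective (trans v∈i (sym x∈i))) (trackOf-injective (trans y∈j (sym w∈j)))
          vw xy v⊏x y⊏w }
      where
      -- A crossing satisfies the hypotheses of `congruent-levels` on either track. With equal
      -- levels the order within a track is that of positions, and `monotone` applies.
      noCrossing : ∀ {v x w y} → colour v ≡ colour x × level v % 3 ≡ level x % 3 →
        colour y ≡ colour w × level y % 3 ≡ level w % 3 → Adj v w → Adj x y → v ⊏ x → ¬ y ⊏ w
      noCrossing (colᵢ , levᵢ) (colⱼ , levⱼ) vw xy v⊏x y⊏w = monotone tt tt tt tt vw xy colᵢ (sym colⱼ)
        (⊏-pos v⊏x (congruent-levels (symmetric vw) xy levᵢ (⊏-level v⊏x) (⊏-level y⊏w)))
        (⊏-pos y⊏w (congruent-levels xy (symmetric vw) levⱼ (⊏-level y⊏w) (⊏-level v⊏x)))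

-- From track layouts to queue layouts

module Queues {n t} (G : Graph n) (A : TrackAssignment G (suc t))
  (noCrossing : ¬ TrackAssignment.XCrossing A) where

  open Graph G
  open TrackAssignment A

  module O {i} = IsStrictTotalOrder (isStrictTotalOrder i)

  span : Fin n → Fin n → ℕ
  span v w = ∣ toℕ (track v) - toℕ (track w) ∣

  span>0 : ∀ {v w} → track v ≢ track w → 0 < span v w
  span>0 v≢w = n≢0⇒n>0 (λ eq → v≢w (Finₚ.toℕ-injective (∣m-n∣≡0⇒m≡n eq)))

  -- Among `suc t` tracks the spans of edges run from 1 to `t`, so `pred` numbers `t` queues; this
  -- makes the inequality of the theorem strict.
  span<t : ∀ {v w} → track v ≢ track w → pred (span v w) < t
  span<t {v} {w} v≢w with span v w in eq | span>0 {v} {w} v≢w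
  ... | suc k | _ = ≤-trans (≤-reflexive (sym eq)) (≤-trans (∣m-n∣≤m⊔n (toℕ (track v)) (toℕ (track w)))
    (⊔-lub (Finₚ.toℕ≤pred[n] (track v)) (Finₚ.toℕ≤pred[n] (track w))))

  _⊏_ : Rel (Fin n) 0ℓ
  v ⊏ w = toℕ (track v) < toℕ (track w) ⊎ Σ (track v ≡ track w) λ eq → (v , eq) ≺ (w , refl)

  ⊏-irrefl : ∀ {v} → ¬ v ⊏ v
  ⊏-irrefl (inj₁ v<v)       = <-irrefl refl v<v
  ⊏-irrefl (inj₂ (_ , v≺v)) = O.irrefl refl v≺v

  -- Elements of a track carry a proof of membership, but its order respects equality of the
  -- vertices alone.
  ≺-resp : ∀ {i v w} {v∈ v∈′ : track v ≡ i} {w∈ w∈′ : track w ≡ i} →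
    _≺_ {i} (v , v∈) (w , w∈) → _≺_ {i} (v , v∈′) (w , w∈′)
  ≺-resp v≺w = O.<-respˡ-≈ refl (O.<-respʳ-≈ refl v≺w)

  ⊏-same : ∀ {i v w} {v∈ : track v ≡ i} {w∈ : track w ≡ i} → v ⊏ w → _≺_ {i} (v , v∈) (w , w∈)
  ⊏-same {v∈ = v∈} {w∈} (inj₁ v<w) = contradiction v<w (<-irrefl (cong toℕ (trans v∈ (sym w∈))))
  ⊏-same {w∈ = refl} (inj₂ (_ , v≺w)) = ≺-resp v≺w

  ⊏-trans : ∀ {u v w} → u ⊏ v → v ⊏ w → u ⊏ w
  ⊏-trans (inj₁ u<v) (inj₁ v<w) = inj₁ (<-trans u<v v<w)
  ⊏-trans (inj₁ u<v) (inj₂ (v≡w , _)) = inj₁ (<-≤-trans u<v (≤-reflexive (cong toℕ v≡w)))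
  ⊏-trans (inj₂ (u≡v , _)) (inj₁ v<w) = inj₁ (≤-<-trans (≤-reflexive (cong toℕ u≡v)) v<w)
  ⊏-trans u⊏v@(inj₂ (u≡v , _)) (inj₂ (v≡w , v≺w)) =
    inj₂ (trans u≡v v≡w , O.trans (⊏-same {v∈ = trans u≡v v≡w} {w∈ = v≡w} u⊏v) v≺w)

  ⊏-compare : ∀ v w → Tri (v ⊏ w) (v ≡ w) (w ⊏ v)
  ⊏-compare v w with <-cmp (toℕ (track v)) (toℕ (track w))
  ... | tri< v<w v≢w v≯w = tri< (inj₁ v<w) (λ { refl → v≢w refl })
    [ v≯w , (λ { (eq , _) → v≢w (cong toℕ (sym eq)) }) ]′
  ... | tri> v≮w v≢w w<v = tri> [ v≮w , (λ { (eq , _) → v≢w (cong toℕ eq) }) ]′ (λ { refl → v≢w refl }) (inj₁ w<v)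
  ... | tri≈ _ v≡w _ with O.compare (v , Finₚ.toℕ-injective v≡w) (w , refl)
  ...   | tri< v≺w v≢w v⊁w = tri< (inj₂ (_ , v≺w)) v≢w (v⊁w ∘ ⊏-same)
  ...   | tri> v⊀w v≢w w≺v = tri> (v⊀w ∘ ⊏-same) v≢w (inj₂ (sym (Finₚ.toℕ-injective v≡w) , flip w≺v))
    where
    flip : ∀ {i v w} {v∈ : track v ≡ i} {w∈ : track w ≡ i} {w∈′ : track w ≡ track v} →
           _≺_ {i} (w , w∈) (v , v∈) → (w , w∈′) ≺ (v , refl)
    flip {v∈ = refl} w≺v = ≺-resp w≺v
  ...   | tri≈ _ refl _ = tri≈ ⊏-irrefl refl ⊏-irrefl

  ⊏-track : ∀ {v w} → v ⊏ w → toℕ (track v) ≤ toℕ (track w)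
  ⊏-track (inj₁ v<w)       = <⇒≤ v<w
  ⊏-track (inj₂ (v≡w , _)) = ≤-reflexive (cong toℕ v≡w)

  -- Nesting puts the tracks in the order `a ≤ b ≤ c ≤ d`. Equal spans then force `a ≡ b` and
  -- `c ≡ d`, so the two edges join the same two tracks and cross.
  noNesting : ∀ {v w x y} (e : Adj v w) (f : Adj x y) →
    fromℕ< (span<t {v} {w} (proper e)) ≡ fromℕ< (span<t {x} {y} (proper f)) → ¬ (v ⊏ x × x ⊏ y × y ⊏ w)
  noNesting {v} {w} {x} {y} e f eq (v⊏x , x⊏y , y⊏w) = noCrossing (track v , track w , proper e ,
    (v , refl) , (x , sym v≡x) , (w , refl) , (y , y≡w) , e , f , ⊏-same v⊏x , ⊏-same y⊏w)
    where
    a = toℕ (track v)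
    b = toℕ (track x)
    c = toℕ (track y)
    d = toℕ (track w)
    span≡ : span v w ≡ span x y
    span≡ = trans (sym (suc-pred (span v w) {{ℕ.>-nonZero (span>0 (proper e))}}))
      (trans (cong suc (Finₚ.fromℕ<-injective _ _ _ _ eq))
          (suc-pred (span x y) {{ℕ.>-nonZero (span>0 (proper f))}}))
    b≤c : b ≤ c
    b≤c = ⊏-track x⊏y
    a≤d : a ≤ d
    a≤d = ≤-trans (⊏-track v⊏x) (≤-trans b≤c (⊏-track y⊏w))
    gap≡ : d ∸ a ≡ c ∸ b
    gap≡ = trans (sym (m≤n⇒∣m-n∣≡n∸m a≤d)) (trans span≡ (m≤n⇒∣m-n∣≡n∸m b≤c))
    d≡c : d ≡ c
    d≡c = ≤-antisym (begin
      d            ≡⟨ m+[n∸m]≡n a≤d ⟨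
      a + (d ∸ a)  ≡⟨ cong (λ k → a + k) gap≡ ⟩
      a + (c ∸ b)  ≤⟨ +-monoˡ-≤ (c ∸ b) (⊏-track v⊏x) ⟩
      b + (c ∸ b)  ≡⟨ m+[n∸m]≡n b≤c ⟩
      c            ∎) (⊏-track y⊏w)
      where open ≤-Reasoning
    y≡w : track y ≡ track w
    y≡w = Finₚ.toℕ-injective (sym d≡c)
    v≡x : track v ≡ track x
    v≡x = Finₚ.toℕ-injective (∸-cancelˡ-≡ a≤d (≤-trans b≤c (≤-reflexive (sym d≡c)))
      (trans gap≡ (cong (λ k → k ∸ b) (sym d≡c))))

  queueLayout : QueueLayout G t
  queueLayout = record
    { _≺_ = _⊏_
    ; isStrictTotalOrder = record
      { isStrictPartialOrder = record
        { isEquivalence = isEquivalence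
        ; irrefl        = λ { refl → ⊏-irrefl }
        ; trans         = ⊏-trans
        ; <-resp-≈      = (λ { refl v⊏w → v⊏w }) , λ { refl v⊏w → v⊏w }
        }
      ; compare = ⊏-compare
      }
    ; queue           = λ {v} {w} e → fromℕ< (span<t {v} {w} (proper e))
    ; queue-unordered = λ {v} {w} e e′ →
        Finₚ.fromℕ<-cong _ _ (cong pred (∣-∣-comm (toℕ (track v)) (toℕ (track w)))) _ _
    ; noNesting       = noNesting
    }

-- The bound

module Drawing {n} (G : Graph n) (S : CellularSurface) (emb : Embedding G S) where

  open Graph G
  open CellularSurface S
  open Embedding emb
  open Surface S
  open Triangulation S

  level : Fin n → ℕ
  level v = V.depth (vertex v)

  level-edge : ∀ {u v} → Adj u v → level u ≤ suc (level v)
  level-edge e with edge e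
  ... | a , va , vb = V.depth-step (a , va , vb)

  open Layouts Adj level
  open Tracks G level level-edge

  home : Fin n → Flag
  home v = triangle (flagAt (vertex v))

  Z : Fin (extras + extras) → Fin n → Set
  Z i v = T.Anc (vertex v) (extraEnds i)

  Bag : Flag → Fin 3 → Fin n → Set
  Bag x i v = T.Anc (vertex v) (corners x i)

  anc : ∀ {x y} → x ≡ y → T.Anc y x
  anc refl = T.anc-refl _

  home∈Bag : ∀ v → ∃ λ i → Bag (home v) i v
  home∈Bag v with triangle-flags (flagAt (vertex v))
  ... | inj₁ eq = zero , anc (trans (cong vertexOf eq) (vertex-flagAt _))
  ... | inj₂ eq = suc zero , anc (trans (cong vertexOf (trans (cong θ₀ eq) (θ₀-involutive _))) (vertex-flagAt _))

  -- The edge is drawn along a flag `a`. By `same-branch` the home of `u` goes with the triangle of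
  -- `a` and the home of `v` with that of `θ₀ a`, which is the same triangle.
  branch-edge : ∀ {x u v} → ¬ (∃ λ i → Z i u) → ¬ (∃ λ i → Z i v) →
    ¬ (∃ λ i → Bag x i u) → ¬ (∃ λ i → Bag x i v) → Adj u v →
    RootedTree.branch triangles x (home u) ≡ RootedTree.branch triangles x (home v)
  branch-edge u∉Z v∉Z u∉B v∉B e with edge e
  ... | a , va , vb = trans (same-branch u∉Z u∉B (anc (vertex-flagAt _)) (anc va))
      (trans (cong (RootedTree.branch triangles _) (sym (triangle-θ₀ a)))
        (same-branch v∉Z v∉B (anc vb) (anc (vertex-flagAt _))))

  -- The tree paths from the ends of missed edges are peeled off first, all other vertices forming
  -- one piece; hence the constant label. Then `p` rounds of three colours follow.
  vertexLayout : ∀ p → n < 2 ^ p → Layout (λ _ → ⊤) (extras + extras + p * 3) (1 * flags ^ p)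
  vertexLayout p n<2^p = peel (λ _ _ _ _ _ → refl) λ ℓ →
    Separators.layout triangles home Bag (λ x i v → T.anc? (vertex v) (corners x i))
      (λ {x} {i} → Bag-unique {x} {i}) home∈Bag
      (λ v → ∃ λ i → Z i v) branch-edge p (piece? ℓ) (λ v∈P → proj₁ (proj₂ v∈P))
      (≤-<-trans (count≤n (piece? ℓ)) n<2^p)
    where
    instance
      flags≢0 : NonZero flags
      flags≢0 = Finₚ.nonZeroIndex someFlag
    Bag-unique : ∀ {x i u v} → Bag x i u → Bag x i v → level u ≡ level v → u ≡ v
    Bag-unique {x} {i} bu bv eq = vertex-injective (T.anc-unique {z = corners x i} bu bv eq)
    open Peel {U = λ _ → ⊤} {N = 1} (m^n>0 flags p) Z (λ i v → T.anc? (vertex v) (extraEnds i))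
      (λ {i} zu zv eq → vertex-injective (T.anc-unique {z = extraEnds i} zu zv eq)) (λ _ → zero)
    piece? : ∀ ℓ → U.Decidable (Piece ℓ)
    piece? ℓ v = yes tt ×-dec (¬? (B? v) ×-dec (zero Finₚ.≟ ℓ))

  tracks : ∀ p → n < 2 ^ p → TrackLayout G ((extras + extras + p * 3) * 3)
  tracks p n<2^p = trackLayout (vertexLayout p n<2^p)

-- The logarithm and the final estimate

n<2^n : ∀ n → n < 2 ^ n
n<2^n zero    = s≤s z≤n
n<2^n (suc n) = begin-strict
  suc n            ≤⟨ n<2^n n ⟩
  2 ^ n            <⟨ m<m+n (2 ^ n) {2 ^ n} (m^n>0 2 n) ⟩
  2 ^ n + 2 ^ n    ≡⟨ cong (λ k → 2 ^ n + k) (sym (+-identityʳ (2 ^ n))) ⟩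
  2 ^ suc n        ∎
  where open ≤-Reasoning

logarithm : ∀ n .{{_ : NonZero n}} → ∃ λ q → 2 ^ q ≤ n × n < 2 ^ suc q
logarithm n@(suc _) with least (λ p → n <? 2 ^ p) {n} (n<2^n n)
... | zero  , n<1 , _   = contradiction n<1 λ { (s≤s ()) }
... | suc q , n<  , min = q , ≮⇒≥ (λ n<2^q → <-irrefl refl (min n<2^q)) , n<

-- Since 3/2 is less than 2, the binary logarithm is the smaller one: `3 ^ q` is at most `4 ^ q`,
-- and one factor `2 ^ q` of the latter is at most `n`.
log-bound : ∀ q {n} → 2 ^ q ≤ n → 3 ^ q ≤ n ^ 1 * 2 ^ q
log-bound q {n} 2^q≤n = begin
  3 ^ q            ≤⟨ ^-monoˡ-≤ q {3} {4} (n≤1+n 3) ⟩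
  4 ^ q            ≡⟨ ^-*-assoc 2 2 q ⟩
  2 ^ (2 * q)      ≡⟨ ^-distribˡ-+-* 2 q (q + 0) ⟩
  2 ^ q * 2 ^ (q + 0)  ≡⟨ cong (λ k → 2 ^ q * 2 ^ k) (+-identityʳ q) ⟩
  2 ^ q * 2 ^ q    ≤⟨ *-monoˡ-≤ (2 ^ q) 2^q≤n ⟩
  n * 2 ^ q        ≡⟨ cong (λ k → k * 2 ^ q) (*-identityʳ n) ⟨
  n ^ 1 * 2 ^ q    ∎
  where open ≤-Reasoning

track-bound : ∀ {x g} q → x ≤ g → (x + x + suc q * 3) * 3 ≤ 6 * g + 9 * (1 + q)
track-bound {x} {g} q x≤g = begin
  (x + x + suc q * 3) * 3  ≤⟨ *-monoˡ-≤ 3 (+-monoˡ-≤ (suc q * 3) (+-mono-≤ x≤g x≤g)) ⟩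
  (g + g + suc q * 3) * 3  ≡⟨ solve 2 (λ g q → (g :+ g :+ (con 1 :+ q) :* con 3) :* con 3 :=
                                con 6 :* g :+ con 9 :* (con 1 :+ q)) refl g q ⟩
  6 * g + 9 * (1 + q)      ∎
  where
  open ≤-Reasoning
  open ℕSolver.+-*-Solver

rational-bound : ∀ {t} g q → t ≤ 6 * g + 9 * (1 + q) →
  (+ t / 1) ℚ.≤ (+ (6 * g) / 1) ℚ.+ (+ 9 / 1) ℚ.* (ℚ.1ℚᵘ ℚ.+ ℚ.mkℚᵘ (+ q) 0)
rational-bound {t} g q t≤ = ℚ.*≤* (ℤₚ.≤-trans (ℤₚ.*-monoʳ-≤-nonNeg (+ 1) (ℤ.+≤+ t≤)) (ℤₚ.≤-reflexive (begin
  + (6 * g + 9 * (1 + q)) ℤ.* + 1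
    ≡⟨ cong (λ k → (+ (6 * g) ℤ.+ k) ℤ.* + 1) (ℤₚ.pos-* 9 (1 + q)) ⟩
  (+ (6 * g) ℤ.+ + 9 ℤ.* (+ 1 ℤ.+ + q)) ℤ.* + 1
    ≡⟨ solve 2 (λ a q → (a :+ con (+ 9) :* (con (+ 1) :+ q)) :* con (+ 1) :=
         (a :* con (+ 1) :+ con (+ 9) :* (con (+ 1) :* con (+ 1) :+ q :* con (+ 1)) :* con (+ 1)) :* con (+ 1))
         refl (+ (6 * g)) (+ q) ⟩
  (+ (6 * g) ℤ.* + 1 ℤ.+ + 9 ℤ.* (+ 1 ℤ.* + 1 ℤ.+ + q ℤ.* + 1) ℤ.* + 1) ℤ.* + 1  ∎)))
  where
  open ≡-Reasoning
  open +-*-Solver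

theorem32 : ∀ (n : ℕ) .{{_ : NonZero n}} (G : Graph n) (g : ℕ) → IsEulerGenus G g →
    ∀ (qn tn : ℕ) → IsQueueNumber G qn → IsTrackNumber G tn →
    qn < tn × (+ tn / 1) ≤ (+ (6 * g) / 1) + (+ 9 / 1) *[1+log₃/₂ n ]
theorem32 n@(suc _) G g ((S , χ , emb) , _) qn tn (_ , qn-min) ((A , noCrossing) , tn-min)
  with tn | logarithm n
-- As `n` is positive, there is a vertex, which needs a track.
... | zero  | _ = contradiction (TrackAssignment.track A zero) λ ()
... | suc t | q , 2^q≤n , n<2^1+q =
  s≤s (qn-min t (Queues.queueLayout G A noCrossing)) ,
  -- The rational witness is the integer part `q` of the binary logarithm; the 0 encodes denominator
  -- 1. The layout makes `suc q` rounds because `n < 2 ^ suc q`.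
  ℚ.mkℚᵘ (+ q) 0 , log-bound q 2^q≤n ,
  rational-bound g q (≤-trans (tn-min _ (tracks (suc q) n<2^1+q)) (track-bound q (extras-genus χ)))
  where
  open Drawing G S emb
  open Triangulation S using (extras-genus)
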